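{- Let $n,m,r,\lambda$ be positive integers with $n>m>2$, and let a partial $r$-factorization of $G:=\lambda K_m$ (with respect to $n$) be given. It can be extended to a connected $r$-factorization of $\lambda K_n$ if and only if (i) $(n,r,\lambda)$ is $2$-admissible; (ii) no component of any color class of $G$ is $r$-regular; (iii) for all $j\in[k]$, where $k:=\lambda(n-1)/r$, $$rm-\frac{rn}{2}\le |E(G(j))|\le \frac{rn}{2}-n+m-c(G(j))+1.$$
   Context: $\lambda K_n$ is the loopless multigraph on $n$ vertices with every pair of vertices joined by $\lambda$ edges; $\lambda K_m$ is its subgraph induced on a fixed set of $m$ vertices. An $r$-factor is a spanning subgraph in which every vertex has degree $r$. With $k=\lambda(n-1)/r$, a partial $r$-factorization of $\lambda K_m$ is a coloring of its edges with colors from $[k]$ such that every vertex has degree at most $r$ in each color class; $G(j)$ is color class $j$ (spanning subgraph on all $m$ vertices, possibly edgeless) and $c(\cdot)$ counts components including isolated vertices. It extends to a connected $r$-factorization of $\lambda K_n$ if some coloring of all edges of $\lambda K_n$ with colors from $[k]$ agrees with it on $\lambda K_m$ and every color class is a connected $r$-factor. $(n,r,\lambda)$ is $2$-admissible if $2\mid rn$ and $r\mid\lambda(n-1)$. -}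

module Defs where

open import Data.Nat using (ℕ; zero; suc; _+_; _*_; _∸_; _≤_; _<_)
open import Data.Nat.Divisibility using (_∣_)
open import Data.Fin as F using (Fin; inject≤)
open import Data.Fin.Properties using (_<?_) renaming (_≟_ to _≟ᶠ_)
open import Data.Product using (Σ; ∃; _×_; _,_)
open import Relation.Binary.PropositionalEquality using (_≡_; _≢_)
open import Relation.Nullary using (Dec; yes; no; ¬_)
open import Relation.Nullary.Decidable using (_×-dec_; ¬?)

sumFin : ∀ {N} → (Fin N → ℕ) → ℕ
sumFin {zero} f = 0
sumFin {suc N} f = f F.zero + sumFin (λ i → f (F.suc i))

ind : ∀ {A : Set} → Dec A → ℕ
ind (yes _) = 1
ind (no _) = 0

-- An edge colouring of lam·K_N with colours Fin k.
-- The copies of the edge {u,v} (u ≠ v) are indexed by Fin lam; the colour of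
-- copy c of {u,v} is col u v c, which must not depend on the orientation.
-- Values col u u c (diagonal) are meaningless (the multigraph is loopless).
record EdgeColouring (N lam k : ℕ) : Set where
  field
    col : Fin N → Fin N → Fin lam → Fin k
    sym : ∀ u v c → col u v c ≡ col v u c
open EdgeColouring public

module _ {N lam k : ℕ} (χ : EdgeColouring N lam k) where

  deg : Fin N → Fin k → ℕ
  deg v j = sumFin (λ w → sumFin (λ c → ind (¬? (w ≟ᶠ v) ×-dec (col χ w v c ≟ᶠ j))))

  edges : Fin k → ℕ
  edges j = sumFin (λ u → sumFin (λ v → sumFin (λ c → ind ((u <? v) ×-dec (col χ u v c ≟ᶠ j)))))

  Adj : Fin k → Fin N → Fin N → Set
  Adj j u v = u ≢ v × ∃ (λ c → col χ u v c ≡ j)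

  data Reach (j : Fin k) : Fin N → Fin N → Set where
    here : ∀ {u} → Reach j u u
    step : ∀ {u v w} → Reach j u v → Adj j v w → Reach j u w

  -- c is the number of components (incl. isolated vertices) of colour class j:
  -- there is a surjective labelling of vertices by Fin c whose fibres are
  -- exactly the reachability classes.
  IsComponentCount : Fin k → ℕ → Set
  IsComponentCount j c =
    Σ (Fin N → Fin c) λ ℓ →
      (∀ i → ∃ λ v → ℓ v ≡ i) ×
      (∀ u v → (ℓ u ≡ ℓ v → Reach j u v) × (Reach j u v → ℓ u ≡ ℓ v))

  IsPartialFactorization : ℕ → Set
  IsPartialFactorization r = ∀ v j → deg v j ≤ r

  IsConnectedFactorization : ℕ → Set
  IsConnectedFactorization r = ∀ j → (∀ v → deg v j ≡ r) × (∀ u v → Reach j u v)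

  NoRegularComponent : ℕ → Set
  NoRegularComponent r = ∀ j v → ¬ (∀ u → Reach j v u → deg u j ≡ r)

Extends : ∀ {m n lam k} → m ≤ n → EdgeColouring m lam k → EdgeColouring n lam k → Set
Extends {m} {n} {lam} m≤n χ ψ =
  ∀ (u v : Fin m) (c : Fin lam) → u ≢ v →
    col ψ (inject≤ u m≤n) (inject≤ v m≤n) c ≡ col χ u v c

TwoAdmissible : ℕ → ℕ → ℕ → Set
TwoAdmissible n r lam = (2 ∣ r * n) × (r ∣ lam * (n ∸ 1))

{-# OPTIONS --safe #-}

-- New vertices are added one at a time, keeping (ii) and (iii). Suppose p ≥ 2
-- vertices are missing. The degree deficits d v j = r - deg v j, divided by p,
-- form a fractional choice of the colours of the λ edges from each old vertex v
-- to the new vertex β. Rounding this to an integral x v j is a circulation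
-- problem (root → vertex → component → colour → root), so all sums over
-- components and colours can be rounded up or down at once. Colour j then has
-- X edges at β and merges the t components it touches, so (iii) at the next
-- stage asks that X - t not exceed the surplus of edges, which holds because a
-- component contributing x ≥ 2 edges has deficit more than (x - 1)p. Components
-- of deficit 1 are grouped together: (iii) bounds their total deficit by
-- (r - 1)p, so they do not use up β, and (ii) survives. When p = 1 all deficits
-- are spent on β, and (ii) makes every colour class connected.
-- Conversely, removing β adds t - 1 components to a colour class and deletes
-- X ≥ t edges, so (iii) is inherited from the connected factorization.
module Submission where

open import Defs hiding (sym)
open import Data.Bool using (Bool; true; false; _∧_; _∨_)
open import Data.Fin as F using (Fin; inject₁; fromℕ; fromℕ<; inject≤; punchIn; punchOut; splitAt; remQuot; combine; _↑ˡ_; _↑ʳ_)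
open import Data.Fin.Properties using (any?; inject₁-injective; fromℕ≢inject₁; toℕ-injective; toℕ-inject₁; toℕ-inject≤; inject≤-refl; punchIn-punchOut; punchOut-injective; punchOut-punchIn; punchOut-cong; splitAt-↑ˡ; splitAt-↑ʳ; remQuot-combine) renaming (_≟_ to _≟ᶠ_; _<?_ to _<ᶠ?_; <-cmp to <ᶠ-cmp)
open import Data.Fin.Relation.Unary.Top using (view; ‵fromℕ; ‵inject₁)
open import Data.Fin.Subset.Properties using (anySubset?)
open import Data.Nat using (ℕ; zero; suc; _+_; _*_; _∸_; _/_; _%_; _≤_; _<_; z≤n; s≤s; s≤s⁻¹; NonZero; >-nonZero)
open import Data.Nat.DivMod using (/-monoˡ-≤; m/n*n≤m; m/n*n≡m; m≡m%n+[m/n]*n; m%n<n)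
open import Data.Nat.Divisibility using (divides)
open import Data.Nat.Properties
open import Data.Nat.Tactic.RingSolver using (solve-∀)
open import Data.Product using (Σ; ∃; _×_; _,_; proj₁; proj₂; uncurry)
open import Data.Sum using (_⊎_; inj₁; inj₂)
open import Data.Vec using (lookup; tabulate)
open import Data.Vec.Properties using (lookup∘tabulate)
open import Function using (_∘_)
open import Function.Bundles using (_⇔_; mk⇔)
open import Relation.Binary.Definitions using (tri<; tri≈; tri>)
open import Relation.Binary.PropositionalEquality using (_≡_; _≢_; refl; sym; trans; cong; cong₂; subst; subst₂; ≢-sym; module ≡-Reasoning)
open import Relation.Nullary using (Dec; yes; no; ¬_; contradiction; does)
open import Relation.Nullary.Decidable using (_×-dec_; ¬?)

-- Condition (iii) is best read through the edges still to be placed. If a colour has total deficit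
-- D and h of its edges are to join two missing vertices, then D + 2h = rp. The lower bound in (iii)
-- says h ≥ 0. The upper bound says p + c ≤ D + h + 1: with each component contracted to a point, D
-- + h edges must connect p + c points. Dividing the deficits by p is natural because the missing
-- vertices are interchangeable: in any extension, the edges of colour j from v to them average to d
-- v j / p. The obstacle is (ii). If β had r edges, all to components whose deficits they exhaust,
-- its component would be r-regular and closed too early. While p ≥ 2, rounding never exhausts a
-- component of deficit at least 2, since that would need δp < δ + p; a component of deficit 1 can
-- be exhausted. So only these need a joint bound.

private variable N M m k lam : ℕ

-- Finite sums

sum-cong : {f g : Fin N → ℕ} → (∀ i → f i ≡ g i) → sumFin f ≡ sumFin g
sum-cong {zero}  h = refl
sum-cong {suc N} h = cong₂ _+_ (h F.zero) (sum-cong (λ i → h (F.suc i)))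

sum-mono : {f g : Fin N → ℕ} → (∀ i → f i ≤ g i) → sumFin f ≤ sumFin g
sum-mono {zero}  h = z≤n
sum-mono {suc N} h = +-mono-≤ (h F.zero) (sum-mono (λ i → h (F.suc i)))

interchange : ∀ a b c d → (a + b) + (c + d) ≡ (a + c) + (b + d)
interchange = solve-∀

sum-+ : (f g : Fin N → ℕ) → sumFin (λ i → f i + g i) ≡ sumFin f + sumFin g
sum-+ {zero}  f g = refl
sum-+ {suc N} f g =
  trans (cong (f F.zero + g F.zero +_) (sum-+ (λ i → f (F.suc i)) (λ i → g (F.suc i))))
        (interchange (f F.zero) (g F.zero) _ _)

sum-*ˡ : ∀ a (f : Fin N → ℕ) → sumFin (λ i → a * f i) ≡ a * sumFin f
sum-*ˡ {zero}  a f = sym (*-zeroʳ a)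
sum-*ˡ {suc N} a f =
  trans (cong (a * f F.zero +_) (sum-*ˡ a (λ i → f (F.suc i)))) (sym (*-distribˡ-+ a (f F.zero) _))

sum-*ʳ : ∀ a (f : Fin N → ℕ) → sumFin (λ i → f i * a) ≡ sumFin f * a
sum-*ʳ a f = trans (sum-cong (λ i → *-comm (f i) a)) (trans (sum-*ˡ a f) (*-comm a _))

sum-const : ∀ N a → sumFin {N} (λ _ → a) ≡ N * a
sum-const zero    a = refl
sum-const (suc N) a = cong (a +_) (sum-const N a)

sum-zero : {f : Fin N → ℕ} → (∀ i → f i ≡ 0) → sumFin f ≡ 0
sum-zero {N} h = trans (sum-cong h) (trans (sum-const N 0) (*-zeroʳ N))

sum-swap : (f : Fin N → Fin M → ℕ) → sumFin (λ i → sumFin (f i)) ≡ sumFin (λ j → sumFin (λ i → f i j))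
sum-swap {zero} {M} f = sym (sum-zero {M} (λ _ → refl))
sum-swap {suc N} f =
  trans (cong (sumFin (f F.zero) +_) (sum-swap (λ i → f (F.suc i))))
        (sym (sum-+ (f F.zero) (λ j → sumFin (λ i → f (F.suc i) j))))

sum-last : (f : Fin (suc N) → ℕ) → sumFin f ≡ sumFin (λ i → f (inject₁ i)) + f (fromℕ N)
sum-last {zero}  f = +-comm (f F.zero) 0
sum-last {suc N} f =
  trans (cong (f F.zero +_) (sum-last (λ i → f (F.suc i)))) (sym (+-assoc (f F.zero) _ _))

sum-↑ : ∀ N {M} (f : Fin (N + M) → ℕ) → sumFin f ≡ sumFin (λ i → f (i ↑ˡ M)) + sumFin (λ i → f (N ↑ʳ i))
sum-↑ zero    f = refl
sum-↑ (suc N) f =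
  trans (cong (f F.zero +_) (sum-↑ N (λ i → f (F.suc i)))) (sym (+-assoc (f F.zero) _ _))

sum-combine : ∀ N {M} (f : Fin (N * M) → ℕ) → sumFin f ≡ sumFin (λ i → sumFin (λ j → f (combine {N} i j)))
sum-combine zero        f = refl
sum-combine (suc N) {M} f =
  trans (sum-↑ M f) (cong (sumFin (λ j → f (j ↑ˡ (N * M))) +_) (sum-combine N (λ i → f (M ↑ʳ i))))

ind-⇔ : {A B : Set} (a : Dec A) (b : Dec B) → (A → B) → (B → A) → ind a ≡ ind b
ind-⇔ (yes _) (yes _) f g = refl
ind-⇔ (yes x) (no ¬y) f g = contradiction (f x) ¬y
ind-⇔ (no ¬x) (yes y) f g = contradiction (g y) ¬x
ind-⇔ (no _)  (no _)  f g = refl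

ind-yes : {A : Set} (a : Dec A) → A → ind a ≡ 1
ind-yes a x = ind-⇔ a (yes x) (λ z → z) (λ z → z)

ind-no : {A : Set} (a : Dec A) → ¬ A → ind a ≡ 0
ind-no a ¬x = ind-⇔ a (no ¬x) (λ z → z) (λ z → z)

ind-× : {A B : Set} (a : Dec A) (b : Dec B) → ind (a ×-dec b) ≡ ind a * ind b
ind-× (yes _) (yes _) = refl
ind-× (yes _) (no _)  = refl
ind-× (no _)  b       = refl

sum-δ : (a : Fin N) (f : Fin N → ℕ) → sumFin (λ i → ind (a ≟ᶠ i) * f i) ≡ f a
sum-δ {suc N} F.zero f =
  trans (cong₂ _+_ (+-identityʳ (f F.zero))
           (sum-zero {N} (λ i → cong (_* f (F.suc i)) (ind-no (F.zero ≟ᶠ F.suc i) λ ()))))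
        (+-identityʳ _)
sum-δ {suc N} (F.suc a) f =
  trans (sum-cong {N} (λ i → cong (_* f (F.suc i))
          (ind-⇔ (F.suc a ≟ᶠ F.suc i) (a ≟ᶠ i) (λ { refl → refl }) (λ { refl → refl }))))
        (sum-δ a (λ i → f (F.suc i)))

term≤sum : (f : Fin N → ℕ) (i : Fin N) → f i ≤ sumFin f
term≤sum f F.zero    = m≤m+n _ _
term≤sum f (F.suc i) = ≤-trans (term≤sum (λ i → f (F.suc i)) i) (m≤n+m _ (f F.zero))

sum-tight : {f g : Fin N → ℕ} → (∀ i → f i ≤ g i) → sumFin g ≤ sumFin f → ∀ i → f i ≡ g i
sum-tight {suc N} {f} {g} h s F.zero = ≤-antisym (h F.zero)
  (+-cancelʳ-≤ _ _ _ (≤-trans s (+-monoʳ-≤ (f F.zero) (sum-mono (λ i → h (F.suc i))))))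
sum-tight {suc N} {f} {g} h s (F.suc i) = sum-tight (λ i → h (F.suc i))
  (+-cancelˡ-≤ (g F.zero) _ _ (≤-trans s (+-monoˡ-≤ _ (h F.zero)))) i

sum-<⇒∃ : (f g : Fin N → ℕ) → sumFin f < sumFin g → ∃ λ i → f i < g i
sum-<⇒∃ {suc N} f g s with <-≤-connex (f F.zero) (g F.zero)
... | inj₁ lt = F.zero , lt
... | inj₂ ge with sum-<⇒∃ (λ i → f (F.suc i)) (λ i → g (F.suc i))
                         (+-cancelˡ-< (g F.zero) _ _ (≤-<-trans (+-monoˡ-≤ _ ge) s))
...   | i , lt = F.suc i , lt

sum-pos⇒∃ : (f : Fin N → ℕ) → 0 < sumFin f → ∃ λ i → 0 < f i
sum-pos⇒∃ {N} f s = sum-<⇒∃ (λ _ → 0) f (subst (_< sumFin f) (sym (sum-zero {N} (λ _ → refl))) s)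

ind-sym : (a b : Fin N) → ind (a ≟ᶠ b) ≡ ind (b ≟ᶠ a)
ind-sym a b = ind-⇔ (a ≟ᶠ b) (b ≟ᶠ a) sym sym

classSum : (Fin N → Fin M) → (Fin N → ℕ) → Fin M → ℕ
classSum ℓ f i = sumFin (λ v → ind (ℓ v ≟ᶠ i) * f v)

sum-classSum : (ℓ : Fin N → Fin M) (f : Fin N → ℕ) → sumFin (classSum ℓ f) ≡ sumFin f
sum-classSum ℓ f = trans (sum-swap (λ i v → ind (ℓ v ≟ᶠ i) * f v)) (sum-cong (λ v → sum-δ (ℓ v) (λ _ → f v)))

ind-pos : {A : Set} (a : Dec A) → 0 < ind a → A
ind-pos (yes x) _ = x

-- Summing `pos` over classes counts those where a value is not zero; components, touched components
-- and used labels are all counted this way.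
pos : ℕ → ℕ
pos zero    = 0
pos (suc _) = 1

pos≤ : ∀ n → pos n ≤ n
pos≤ zero    = z≤n
pos≤ (suc _) = s≤s z≤n

pos-≡1 : ∀ {n} → 0 < n → pos n ≡ 1
pos-≡1 {suc _} _ = refl

term≤classSum : (ℓ : Fin N → Fin M) (f : Fin N → ℕ) (v : Fin N) → f v ≤ classSum ℓ f (ℓ v)
term≤classSum ℓ f v = subst (_≤ classSum ℓ f (ℓ v))
  (trans (cong (_* f v) (ind-yes (ℓ v ≟ᶠ ℓ v) refl)) (*-identityˡ (f v)))
  (term≤sum (λ u → ind (ℓ u ≟ᶠ ℓ v) * f u) v)

classSum-<⇒∃ : (ℓ : Fin N → Fin M) (f g : Fin N → ℕ) (i : Fin M) →
  classSum ℓ f i < classSum ℓ g i → ∃ λ v → ℓ v ≡ i × f v < g v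
classSum-<⇒∃ ℓ f g i lt with sum-<⇒∃ (λ v → ind (ℓ v ≟ᶠ i) * f v) (λ v → ind (ℓ v ≟ᶠ i) * g v) lt
... | v , fv<gv with ℓ v ≟ᶠ i
...   | yes e = v , e , subst₂ _<_ (*-identityˡ (f v)) (*-identityˡ (g v)) fv<gv

classSum-pos⇒∃ : (ℓ : Fin N → Fin M) (f : Fin N → ℕ) (i : Fin M) →
  0 < classSum ℓ f i → ∃ λ v → ℓ v ≡ i × 0 < f v
classSum-pos⇒∃ {N} ℓ f i s = classSum-<⇒∃ ℓ (λ _ → 0) f i
  (subst (_< classSum ℓ f i) (sym (sum-zero {N} (λ v → *-zeroʳ (ind (ℓ v ≟ᶠ i))))) s)

sum-via-classes : (ℓ : Fin N → Fin M) (g : Fin M → ℕ) (f : Fin N → ℕ) →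
  sumFin (λ v → g (ℓ v) * f v) ≡ sumFin (λ i → g i * classSum ℓ f i)
sum-via-classes ℓ g f = begin
  sumFin (λ v → g (ℓ v) * f v)
    ≡⟨ sum-cong (λ v → sum-δ (ℓ v) (λ i → g i * f v)) ⟨
  sumFin (λ v → sumFin (λ i → ind (ℓ v ≟ᶠ i) * (g i * f v)))
    ≡⟨ sum-swap (λ v i → ind (ℓ v ≟ᶠ i) * (g i * f v)) ⟩
  sumFin (λ i → sumFin (λ v → ind (ℓ v ≟ᶠ i) * (g i * f v)))
    ≡⟨ sum-cong (λ i → trans (sum-cong (λ v → rearrange (ind (ℓ v ≟ᶠ i)) (g i) (f v)))
                             (sum-*ˡ (g i) (λ v → ind (ℓ v ≟ᶠ i) * f v))) ⟩
  sumFin (λ i → g i * classSum ℓ f i) ∎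
  where
  open ≡-Reasoning
  rearrange : ∀ a b c → a * (b * c) ≡ b * (a * c)
  rearrange = solve-∀

classSum-mono : (ℓ : Fin N → Fin M) {f g : Fin N → ℕ} → (∀ v → f v ≤ g v) → ∀ i → classSum ℓ f i ≤ classSum ℓ g i
classSum-mono ℓ h i = sum-mono (λ v → *-monoʳ-≤ (ind (ℓ v ≟ᶠ i)) (h v))

-- Slack at the single index `a` passes to the whole sum. In `excess-kept` one component provides
-- all the slack that is needed.
sum-mono-at : {f g : Fin N → ℕ} → (∀ i → f i ≤ g i) → ∀ a {e e′} → f a + e ≤ g a + e′ → sumFin f + e ≤ sumFin g + e′
sum-mono-at {suc N} {f} {g} h F.zero {e} {e′} s = begin
  f F.zero + sumFin (λ i → f (F.suc i)) + e   ≡⟨ shift (f F.zero) _ e ⟩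
  f F.zero + e + sumFin (λ i → f (F.suc i))   ≤⟨ +-mono-≤ s (sum-mono (λ i → h (F.suc i))) ⟩
  g F.zero + e′ + sumFin (λ i → g (F.suc i))  ≡⟨ shift (g F.zero) _ e′ ⟨
  g F.zero + sumFin (λ i → g (F.suc i)) + e′  ∎
  where
  open ≤-Reasoning
  shift : ∀ a b c → a + b + c ≡ a + c + b
  shift = solve-∀
sum-mono-at {suc N} {f} {g} h (F.suc a) {e} {e′} s = begin
  f F.zero + sumFin (λ i → f (F.suc i)) + e   ≡⟨ +-assoc (f F.zero) _ e ⟩
  f F.zero + (sumFin (λ i → f (F.suc i)) + e) ≤⟨ +-mono-≤ (h F.zero) (sum-mono-at (λ i → h (F.suc i)) a s) ⟩
  g F.zero + (sumFin (λ i → g (F.suc i)) + e′) ≡⟨ +-assoc (g F.zero) _ e′ ⟨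
  g F.zero + sumFin (λ i → g (F.suc i)) + e′  ∎
  where open ≤-Reasoning

classSum-cong : ∀ {N M} (ℓ : Fin N → Fin M) {f g : Fin N → ℕ} → (∀ v → f v ≡ g v) → ∀ i → classSum ℓ f i ≡ classSum ℓ g i
classSum-cong ℓ h i = sum-cong (λ v → cong (ind (ℓ v ≟ᶠ i) *_) (h v))

pos-⇔ : ∀ {a b} → (0 < a → 0 < b) → (0 < b → 0 < a) → pos a ≡ pos b
pos-⇔ {zero}  {zero}  f g = refl
pos-⇔ {zero}  {suc b} f g = contradiction (g (s≤s z≤n)) λ ()
pos-⇔ {suc a} {zero}  f g = contradiction (f (s≤s z≤n)) λ ()
pos-⇔ {suc a} {suc b} f g = refl

pos≡0 : ∀ {n} → pos n ≡ 0 → n ≡ 0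
pos≡0 {zero} _ = refl

pos≤1 : ∀ n → pos n ≤ 1
pos≤1 zero    = z≤n
pos≤1 (suc _) = s≤s z≤n

sum-punchIn : ∀ {N} (f : Fin (suc N) → ℕ) i → sumFin f ≡ f i + sumFin (λ i′ → f (punchIn i i′))
sum-punchIn         f F.zero    = refl
sum-punchIn {suc N} f (F.suc i) = trans
  (cong (f F.zero +_) (sum-punchIn (λ i → f (F.suc i)) i))
  (e (f F.zero) (f (F.suc i)) _)
  where
  e : ∀ a b c → a + (b + c) ≡ b + (a + c)
  e = solve-∀

-- Circulations

Matrix : ℕ → Set
Matrix N = Fin N → Fin N → ℕ

sum² : Matrix N → ℕ
sum² f = sumFin (λ x → sumFin (f x))

sum²-cong : {f g : Matrix N} → (∀ x y → f x y ≡ g x y) → sum² f ≡ sum² g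
sum²-cong h = sum-cong (λ x → sum-cong (h x))

sum²-mono : {f g : Matrix N} → (∀ x y → f x y ≤ g x y) → sum² f ≤ sum² g
sum²-mono h = sum-mono (λ x → sum-mono (h x))

sum²-+ : (f g : Matrix N) → sum² (λ x y → f x y + g x y) ≡ sum² f + sum² g
sum²-+ f g = trans (sum-cong (λ x → sum-+ (f x) (g x))) (sum-+ (λ x → sumFin (f x)) (λ x → sumFin (g x)))

sum²-tight : {f g : Matrix N} → (∀ x y → f x y ≤ g x y) → sum² g ≤ sum² f → ∀ x y → f x y ≡ g x y
sum²-tight h s x = sum-tight (h x) (≤-reflexive (sym (sum-tight (λ x → sum-mono (h x)) s x)))

Conserved : Matrix N → Set
Conserved f = ∀ x → sumFin (f x) ≡ sumFin (λ y → f y x)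

leaves : Bool → Bool → ℕ
leaves true false = 1
leaves _    _     = 0

module _ (f : Matrix N) (U : Fin N → Bool) where

  outflow inflow : ℕ
  outflow = sum² (λ x y → leaves (U x) (U y) * f x y)
  inflow  = sum² (λ x y → leaves (U y) (U x) * f x y)

module _ {U V : Fin N → Bool} (U≗V : ∀ x → U x ≡ V x) (f : Matrix N) where

  outflow-cong : outflow f U ≡ outflow f V
  outflow-cong = sum²-cong (λ x y → cong₂ (λ a b → leaves a b * f x y) (U≗V x) (U≗V y))

  inflow-cong : inflow f U ≡ inflow f V
  inflow-cong = sum²-cong (λ x y → cong₂ (λ a b → leaves a b * f x y) (U≗V y) (U≗V x))

weigh-+ : (w f g : Matrix N) →
  sum² (λ x y → w x y * (f x y + g x y)) ≡ sum² (λ x y → w x y * f x y) + sum² (λ x y → w x y * g x y)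
weigh-+ w f g = trans (sum²-cong (λ x y → *-distribˡ-+ (w x y) (f x y) (g x y)))
                      (sum²-+ (λ x y → w x y * f x y) (λ x y → w x y * g x y))

+-weigh : (v w f : Matrix N) →
  sum² (λ x y → (v x y + w x y) * f x y) ≡ sum² (λ x y → v x y * f x y) + sum² (λ x y → w x y * f x y)
+-weigh v w f = trans (sum²-cong (λ x y → *-distribʳ-+ (f x y) (v x y) (w x y)))
                      (sum²-+ (λ x y → v x y * f x y) (λ x y → w x y * f x y))

-- The arguments tell whether the two ends of an arc lie in `U`, then whether they lie in `V`. The
-- value is 1 if one end lies only in `U` and the other only in `V`.
crosses : Bool → Bool → Bool → Bool → ℕ
crosses true  false false true  = 1
crosses false true  true  false = 1
crosses _     _     _     _     = 0

crosses-sym : ∀ a b c d → crosses b a d c ≡ crosses a b c d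
crosses-sym true true true true = refl
crosses-sym true true true false = refl
crosses-sym true true false true = refl
crosses-sym true true false false = refl
crosses-sym true false true true = refl
crosses-sym true false true false = refl
crosses-sym true false false true = refl
crosses-sym true false false false = refl
crosses-sym false true true true = refl
crosses-sym false true true false = refl
crosses-sym false true false true = refl
crosses-sym false true false false = refl
crosses-sym false false true true = refl
crosses-sym false false true false = refl
crosses-sym false false false true = refl
crosses-sym false false false false = refl

-- Submodularity of the cut function for a single arc, with its defect: an arc between the two set
-- differences leaves one of the two sets but neither their meet nor their join.
leaves-uncross : ∀ a b c d →
  leaves a b + leaves c d ≡ leaves (a ∧ c) (b ∧ d) + leaves (a ∨ c) (b ∨ d) + crosses a b c d
leaves-uncross true true true true = refl
leaves-uncross true true true false = refl
leaves-uncross true true false true = refl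
leaves-uncross true true false false = refl
leaves-uncross true false true true = refl
leaves-uncross true false true false = refl
leaves-uncross true false false true = refl
leaves-uncross true false false false = refl
leaves-uncross false true true true = refl
leaves-uncross false true true false = refl
leaves-uncross false true false true = refl
leaves-uncross false true false false = refl
leaves-uncross false false true true = refl
leaves-uncross false false true false = refl
leaves-uncross false false false true = refl
leaves-uncross false false false false = refl

module _ (U V : Fin N → Bool) where

  meet join : Fin N → Bool
  meet x = U x ∧ V x
  join x = U x ∨ V x

  crossflow : Matrix N → ℕ
  crossflow f = sum² (λ x y → crosses (U x) (U y) (V x) (V y) * f x y)

  outflow-uncross : ∀ f → outflow f U + outflow f V ≡ outflow f meet + outflow f join + crossflow f
  outflow-uncross f = begin
    outflow f U + outflow f V
      ≡⟨ +-weigh (λ x y → leaves (U x) (U y)) (λ x y → leaves (V x) (V y)) f ⟨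
    sum² (λ x y → (leaves (U x) (U y) + leaves (V x) (V y)) * f x y)
      ≡⟨ sum²-cong (λ x y → cong (_* f x y) (leaves-uncross (U x) (U y) (V x) (V y))) ⟩
    sum² (λ x y → (leaves (meet x) (meet y) + leaves (join x) (join y) + crosses (U x) (U y) (V x) (V y)) * f x y)
      ≡⟨ +-weigh (λ x y → leaves (meet x) (meet y) + leaves (join x) (join y)) (λ x y → crosses (U x) (U y) (V x) (V y)) f ⟩
    sum² (λ x y → (leaves (meet x) (meet y) + leaves (join x) (join y)) * f x y) + crossflow f
      ≡⟨ cong (_+ crossflow f) (+-weigh (λ x y → leaves (meet x) (meet y)) (λ x y → leaves (join x) (join y)) f) ⟩
    outflow f meet + outflow f join + crossflow f ∎
    where open ≡-Reasoning

  inflow-uncross : ∀ f → inflow f U + inflow f V ≡ inflow f meet + inflow f join + crossflow f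
  inflow-uncross f = begin
    inflow f U + inflow f V
      ≡⟨ +-weigh (λ x y → leaves (U y) (U x)) (λ x y → leaves (V y) (V x)) f ⟨
    sum² (λ x y → (leaves (U y) (U x) + leaves (V y) (V x)) * f x y)
      ≡⟨ sum²-cong (λ x y → cong (_* f x y) (trans (leaves-uncross (U y) (U x) (V y) (V x))
           (cong (leaves (meet y) (meet x) + leaves (join y) (join x) +_) (crosses-sym (U x) (U y) (V x) (V y))))) ⟩
    sum² (λ x y → (leaves (meet y) (meet x) + leaves (join y) (join x) + crosses (U x) (U y) (V x) (V y)) * f x y)
      ≡⟨ +-weigh (λ x y → leaves (meet y) (meet x) + leaves (join y) (join x)) (λ x y → crosses (U x) (U y) (V x) (V y)) f ⟩
    sum² (λ x y → (leaves (meet y) (meet x) + leaves (join y) (join x)) * f x y) + crossflow f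
      ≡⟨ cong (_+ crossflow f) (+-weigh (λ x y → leaves (meet y) (meet x)) (λ x y → leaves (join y) (join x)) f) ⟩
    inflow f meet + inflow f join + crossflow f ∎
    where open ≡-Reasoning

-- Hoffman's cut condition: what must enter `U` is at most what may leave it.
Feasible : Matrix N → Matrix N → Set
Feasible l u = ∀ U → inflow l U ≤ outflow u U

crosses≡1 : ∀ a b c d → leaves a b ≡ 1 → leaves d c ≡ 1 → crosses a b c d ≡ 1
crosses≡1 true false false true _ _ = refl

-- The slacks of `U` and `V` add up to those of meet and join plus the gap between `u` and `l` on
-- crossing arcs. The first sum is zero and no term of the second is negative, so crossing arcs have
-- no gap; the arc from `a` to `b` is one of them.
tight-uncross : {l u : Matrix N} → (∀ x y → l x y ≤ u x y) → Feasible l u →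
  ∀ {a b} U V → leaves (U a) (U b) ≡ 1 → leaves (V b) (V a) ≡ 1 →
  inflow l U ≡ outflow u U → inflow l V ≡ outflow u V → l a b ≡ u a b
tight-uncross {l = l} {u} l≤u feas {a} {b} U V Uab Vba tU tV =
  trans (sym (weight-1 l)) (trans (sum²-tight (λ x y → *-monoʳ-≤ (cr x y) (l≤u x y)) crossflow-≥ a b) (weight-1 u))
  where
  cr : Matrix _
  cr x y = crosses (U x) (U y) (V x) (V y)
  weight-1 : ∀ f → cr a b * f a b ≡ f a b
  weight-1 f = trans (cong (_* f a b) (crosses≡1 (U a) (U b) (V a) (V b) Uab Vba)) (*-identityˡ (f a b))
  crossflow-≥ : crossflow U V u ≤ crossflow U V l
  crossflow-≥ = +-cancelˡ-≤ (outflow u (meet U V) + outflow u (join U V)) _ _ (begin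
    outflow u (meet U V) + outflow u (join U V) + crossflow U V u ≡⟨ outflow-uncross U V u ⟨
    outflow u U + outflow u V                                     ≡⟨ cong₂ _+_ tU tV ⟨
    inflow l U + inflow l V                                       ≡⟨ inflow-uncross U V l ⟩
    inflow l (meet U V) + inflow l (join U V) + crossflow U V l
      ≤⟨ +-monoˡ-≤ _ (+-mono-≤ (feas (meet U V)) (feas (join U V))) ⟩
    outflow u (meet U V) + outflow u (join U V) + crossflow U V l ∎)
    where open ≤-Reasoning

δ : Fin N → Fin N → Matrix N
δ a b x y = ind (a ≟ᶠ x) * ind (b ≟ᶠ y)

sum²-δ : ∀ (a b : Fin N) (w : Matrix N) → sum² (λ x y → w x y * δ a b x y) ≡ w a b
sum²-δ a b w = begin
  sum² (λ x y → w x y * (ind (a ≟ᶠ x) * ind (b ≟ᶠ y)))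
    ≡⟨ sum²-cong (λ x y → rearrange (w x y) (ind (a ≟ᶠ x)) (ind (b ≟ᶠ y))) ⟩
  sum² (λ x y → ind (a ≟ᶠ x) * (ind (b ≟ᶠ y) * w x y))
    ≡⟨ sum-cong (λ x → trans (sum-*ˡ (ind (a ≟ᶠ x)) (λ y → ind (b ≟ᶠ y) * w x y))
                             (cong (ind (a ≟ᶠ x) *_) (sum-δ b (w x)))) ⟩
  sumFin (λ x → ind (a ≟ᶠ x) * w x b)
    ≡⟨ sum-δ a (λ x → w x b) ⟩
  w a b ∎
  where
  open ≡-Reasoning
  rearrange : ∀ w i j → w * (i * j) ≡ i * (j * w)
  rearrange = solve-∀

sum²-δ-1 : ∀ (a b : Fin N) → sum² (δ a b) ≡ 1
sum²-δ-1 a b = trans (sum²-cong (λ x y → sym (*-identityˡ (δ a b x y)))) (sum²-δ a b (λ _ _ → 1))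

δ-room : {l u : Matrix N} → (∀ x y → l x y ≤ u x y) → ∀ {a b} → l a b < u a b →
  ∀ x y → l x y + δ a b x y ≤ u x y
δ-room {l = l} {u} l≤u {a} {b} lt x y with a ≟ᶠ x | b ≟ᶠ y
... | yes refl | yes refl = subst (_≤ u a b) (+-comm 1 (l a b)) lt
... | yes _    | no _     = subst (_≤ u x y) (sym (+-identityʳ _)) (l≤u x y)
... | no _     | _        = subst (_≤ u x y) (sym (+-identityʳ _)) (l≤u x y)

inside : Bool → ℕ
inside true  = 1
inside false = 0

leaves+inside : ∀ a b → leaves a b + inside a * inside b ≡ inside a
leaves+inside true  true  = refl
leaves+inside true  false = refl
leaves+inside false true  = refl
leaves+inside false false = refl

module _ (f : Matrix N) (U : Fin N → Bool) where

  internal : ℕ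
  internal = sum² (λ x y → inside (U x) * inside (U y) * f x y)

  outflow+internal : outflow f U + internal ≡ sumFin (λ x → inside (U x) * sumFin (f x))
  outflow+internal = begin
    outflow f U + internal
      ≡⟨ +-weigh (λ x y → leaves (U x) (U y)) (λ x y → inside (U x) * inside (U y)) f ⟨
    sum² (λ x y → (leaves (U x) (U y) + inside (U x) * inside (U y)) * f x y)
      ≡⟨ sum²-cong (λ x y → cong (_* f x y) (leaves+inside (U x) (U y))) ⟩
    sum² (λ x y → inside (U x) * f x y)
      ≡⟨ sum-cong (λ x → sum-*ˡ (inside (U x)) (f x)) ⟩
    sumFin (λ x → inside (U x) * sumFin (f x)) ∎
    where open ≡-Reasoning

  inflow+internal : inflow f U + internal ≡ sumFin (λ y → inside (U y) * sumFin (λ x → f x y))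
  inflow+internal = begin
    inflow f U + internal
      ≡⟨ +-weigh (λ x y → leaves (U y) (U x)) (λ x y → inside (U x) * inside (U y)) f ⟨
    sum² (λ x y → (leaves (U y) (U x) + inside (U x) * inside (U y)) * f x y)
      ≡⟨ sum²-cong (λ x y → cong (λ i → (leaves (U y) (U x) + i) * f x y) (*-comm (inside (U x)) (inside (U y)))) ⟩
    sum² (λ x y → (leaves (U y) (U x) + inside (U y) * inside (U x)) * f x y)
      ≡⟨ sum²-cong (λ x y → cong (_* f x y) (leaves+inside (U y) (U x))) ⟩
    sum² (λ x y → inside (U y) * f x y)
      ≡⟨ sum-swap (λ x y → inside (U y) * f x y) ⟩
    sumFin (λ y → sumFin (λ x → inside (U y) * f x y))
      ≡⟨ sum-cong (λ y → sum-*ˡ (inside (U y)) (λ x → f x y)) ⟩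
    sumFin (λ y → inside (U y) * sumFin (λ x → f x y)) ∎
    where open ≡-Reasoning

  conserved⇒balanced : Conserved f → inflow f U ≡ outflow f U
  conserved⇒balanced cons = +-cancelʳ-≡ internal _ _
    (trans inflow+internal (trans (sum-cong (λ x → cong (inside (U x) *_) (sym (cons x)))) (sym outflow+internal)))

-- Singleton cuts bound each column sum by the row sum. Both families have the same total, so no
-- inequality is strict.
feasible⇒conserved : (f : Matrix N) → Feasible f f → Conserved f
feasible⇒conserved f feas x = sym (sum-tight col≤row (≤-reflexive (sum-swap f)) x)
  where
  col≤row : ∀ x → sumFin (λ y → f y x) ≤ sumFin (f x)
  col≤row x = begin
    sumFin (λ y → f y x)                                     ≡⟨ pick (λ z → sumFin (λ y → f y z)) ⟨
    sumFin (λ z → inside (U z) * sumFin (λ y → f y z))       ≡⟨ inflow+internal f U ⟨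
    inflow f U + internal f U                                ≤⟨ +-monoˡ-≤ _ (feas U) ⟩
    outflow f U + internal f U                               ≡⟨ outflow+internal f U ⟩
    sumFin (λ z → inside (U z) * sumFin (f z))               ≡⟨ pick (λ z → sumFin (f z)) ⟩
    sumFin (f x) ∎
    where
    open ≤-Reasoning
    U : Fin _ → Bool
    U z = does (x ≟ᶠ z)
    inside-does : ∀ z → inside (U z) ≡ ind (x ≟ᶠ z)
    inside-does z with x ≟ᶠ z
    ... | yes _ = refl
    ... | no _  = refl
    pick : ∀ h → sumFin (λ z → inside (U z) * h z) ≡ h x
    pick h = trans (sum-cong (λ z → cong (_* h z) (inside-does z))) (sum-δ x h)

-- Cuts are enumerated as subset vectors. The first hypothesis carries `P` to the tabulated copy of
-- a cut, which agrees with it only pointwise.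
any-cut? : ∀ {P : (Fin N → Bool) → Set} → (∀ {U V} → (∀ x → U x ≡ V x) → P U → P V) → (∀ U → Dec (P U)) → Dec (∃ P)
any-cut? resp P? with anySubset? (λ S → P? (lookup S))
... | yes (S , p) = yes (lookup S , p)
... | no ¬p       = no (λ { (U , p) → ¬p (tabulate U , resp (λ x → sym (lookup∘tabulate U x)) p) })

Circulation : Matrix N → Matrix N → Set
Circulation {N} l u = Σ (Matrix N) λ g → (∀ x y → l x y ≤ g x y) × (∀ x y → g x y ≤ u x y) × Conserved g

-- Integrality enters here: a cut that is not tight has slack at least 1, enough for a unit change
-- on an arc across it.
+-leaves-≤ : ∀ {i o} → i ≤ o → ∀ a b → (leaves a b ≡ 1 → i ≢ o) → i + leaves a b ≤ o
+-leaves-≤ {i} {o} i≤o true  false i≢o = subst (_≤ o) (+-comm 1 i) (≤∧≢⇒< i≤o (i≢o refl))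
+-leaves-≤ {i} {o} i≤o true  true  _   = subst (_≤ o) (sym (+-identityʳ i)) i≤o
+-leaves-≤ {i} {o} i≤o false _     _   = subst (_≤ o) (sym (+-identityʳ i)) i≤o

-- Hoffman's circulation theorem. If l a b < u a b, then u a b can be lowered
-- or l a b raised: tight cuts forbidding both would uncross to l a b ≡ u a b.
hoffman : ∀ t (l u : Matrix N) → (∀ x y → l x y ≤ u x y) → sum² u ≤ t + sum² l → Feasible l u → Circulation l u
hoffman t l u l≤u gap feas with any? (λ a → any? (λ b → l a b <? u a b))
... | no none = u , l≤u , (λ _ _ → ≤-refl) ,
      feasible⇒conserved u (λ U → subst (_≤ outflow u U) (sum²-cong (λ x y → cong (leaves (U y) (U x) *_) (l≡u x y))) (feas U))
  where
  l≡u : ∀ x y → l x y ≡ u x y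
  l≡u x y = ≤-antisym (l≤u x y) (≮⇒≥ (λ lt → none (x , y , lt)))
-- `t` bounds the total gap between `u` and `l`. At `zero` nothing is left of it, and each recursive
-- call closes one unit.
hoffman {N} zero l u l≤u gap feas | yes (a , b , lt) =
  contradiction (sum²-tight l≤u gap a b) (<⇒≢ lt)
hoffman {N} (suc t) l u l≤u gap feas | yes (a , b , lt)
  with any-cut? {N} {λ U → leaves (U a) (U b) ≡ 1 × inflow l U ≡ outflow u U}
         (λ U≗V (p , q) → trans (cong₂ leaves (sym (U≗V a)) (sym (U≗V b))) p ,
            trans (sym (inflow-cong U≗V l)) (trans q (outflow-cong U≗V u)))
         (λ U → (leaves (U a) (U b) ≟ 1) ×-dec (inflow l U ≟ outflow u U))
... | no loose = proj₁ rec , proj₁ (proj₂ rec) ,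
      (λ x y → ≤-trans (proj₁ (proj₂ (proj₂ rec)) x y) (m∸n≤m (u x y) (δ a b x y))) , proj₂ (proj₂ (proj₂ rec))
  where
  u′ : Matrix N
  u′ x y = u x y ∸ δ a b x y
  l+δ≤u : ∀ x y → l x y + δ a b x y ≤ u x y
  l+δ≤u = δ-room l≤u lt
  u≡u′+δ : ∀ x y → u x y ≡ u′ x y + δ a b x y
  u≡u′+δ x y = sym (m∸n+n≡m (≤-trans (m≤n+m _ (l x y)) (l+δ≤u x y)))
  outflow-u : ∀ U → outflow u U ≡ outflow u′ U + leaves (U a) (U b)
  outflow-u U = trans (sum²-cong (λ x y → cong (leaves (U x) (U y) *_) (u≡u′+δ x y)))
    (trans (weigh-+ (λ x y → leaves (U x) (U y)) u′ (δ a b))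
           (cong (outflow u′ U +_) (sum²-δ a b (λ x y → leaves (U x) (U y)))))
  slack : ∀ U → inflow l U + leaves (U a) (U b) ≤ outflow u U
  slack U = +-leaves-≤ (feas U) (U a) (U b) (λ eq t → loose (U , eq , t))
  rec : Circulation l u′
  rec = hoffman t l u′ (λ x y → m+n≤o⇒m≤o∸n (l x y) (l+δ≤u x y))
    (s≤s⁻¹ (subst (_≤ suc t + sum² l) (trans (sum²-cong u≡u′+δ)
      (trans (sum²-+ u′ (δ a b)) (trans (cong (sum² u′ +_) (sum²-δ-1 a b)) (+-comm _ 1)))) gap))
    (λ U → +-cancelʳ-≤ (leaves (U a) (U b)) _ _ (≤-trans (slack U) (≤-reflexive (outflow-u U))))
... | yes (U , Uab , tU)
  with any-cut? {N} {λ V → leaves (V b) (V a) ≡ 1 × inflow l V ≡ outflow u V}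
         (λ U≗V (p , q) → trans (cong₂ leaves (sym (U≗V b)) (sym (U≗V a))) p ,
            trans (sym (inflow-cong U≗V l)) (trans q (outflow-cong U≗V u)))
         (λ V → (leaves (V b) (V a) ≟ 1) ×-dec (inflow l V ≟ outflow u V))
...   | yes (V , Vba , tV) = contradiction (tight-uncross l≤u feas U V Uab Vba tU tV) (<⇒≢ lt)
...   | no loose = proj₁ rec ,
        (λ x y → ≤-trans (m≤m+n (l x y) (δ a b x y)) (proj₁ (proj₂ rec) x y)) , proj₂ (proj₂ rec)
  where
  l′ : Matrix N
  l′ x y = l x y + δ a b x y
  inflow-l′ : ∀ V → inflow l′ V ≡ inflow l V + leaves (V b) (V a)
  inflow-l′ V = trans (weigh-+ (λ x y → leaves (V y) (V x)) l (δ a b))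
                      (cong (inflow l V +_) (sum²-δ a b (λ x y → leaves (V y) (V x))))
  rec : Circulation l′ u
  rec = hoffman t l′ u (δ-room l≤u lt)
    (≤-trans gap (≤-reflexive (trans (sym (+-suc t (sum² l))) (cong (t +_)
      (trans (+-comm 1 (sum² l)) (trans (cong (sum² l +_) (sym (sum²-δ-1 a b))) (sym (sum²-+ l (δ a b)))))))))
    (λ V → subst (_≤ outflow u V) (sym (inflow-l′ V))
      (+-leaves-≤ (feas V) (V b) (V a) (λ eq t → loose (V , eq , t))))

weigh-* : ∀ p (w g : Matrix N) → sum² (λ x y → w x y * (g x y * p)) ≡ sum² (λ x y → w x y * g x y) * p
weigh-* p w g = trans (sum-cong (λ x → trans (sum-cong (λ y → sym (*-assoc (w x y) (g x y) p)))
                                             (sum-*ʳ p (λ y → w x y * g x y))))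
                      (sum-*ʳ p (λ x → sumFin (λ y → w x y * g x y)))

-- The bounds are f / p rounded down and up. The fractional circulation f / p lies between them, so
-- every cut is feasible and `hoffman` gives an integral one. The strict inequalities express these
-- bounds without division.
round-circulation : ∀ p .{{_ : NonZero p}} (f : Matrix N) → Conserved f →
  Σ (Matrix N) λ g → (∀ x y → g x y * p < f x y + p) × (∀ x y → f x y < g x y * p + p) × Conserved g
round-circulation {N} p@(suc p-1) f cons = rounded (hoffman (sum² u) l u l≤u (m≤m+n _ _) feas)
  where
  open ≤-Reasoning
  l u : Matrix N
  l x y = f x y / p
  u x y = (f x y + p-1) / p
  l≤u : ∀ x y → l x y ≤ u x y
  l≤u x y = /-monoˡ-≤ p (m≤m+n (f x y) p-1)
  f≤up : ∀ x y → f x y ≤ u x y * p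
  f≤up x y = +-cancelʳ-≤ p-1 _ _ (begin
    f x y + p-1                             ≡⟨ m≡m%n+[m/n]*n (f x y + p-1) p ⟩
    (f x y + p-1) % p + u x y * p           ≤⟨ +-monoˡ-≤ _ (s≤s⁻¹ (m%n<n (f x y + p-1) p)) ⟩
    p-1 + u x y * p                         ≡⟨ +-comm p-1 _ ⟩
    u x y * p + p-1                         ∎)
  feas : Feasible l u
  feas U = *-cancelʳ-≤ _ _ p (begin
    inflow l U * p                                         ≡⟨ weigh-* p (λ x y → leaves (U y) (U x)) l ⟨
    sum² (λ x y → leaves (U y) (U x) * (l x y * p))        ≤⟨ sum²-mono (λ x y → *-monoʳ-≤ (leaves (U y) (U x)) (m/n*n≤m (f x y) p)) ⟩
    inflow f U                                             ≡⟨ conserved⇒balanced f U cons ⟩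
    outflow f U                                            ≤⟨ sum²-mono (λ x y → *-monoʳ-≤ (leaves (U x) (U y)) (f≤up x y)) ⟩
    sum² (λ x y → leaves (U x) (U y) * (u x y * p))        ≡⟨ weigh-* p (λ x y → leaves (U x) (U y)) u ⟩
    outflow u U * p                                        ∎)
  rounded : Circulation l u → Σ (Matrix N) λ g →
    (∀ x y → g x y * p < f x y + p) × (∀ x y → f x y < g x y * p + p) × Conserved g
  rounded (g , l≤g , g≤u , cg) = g , above , below , cg
    where
    above : ∀ x y → g x y * p < f x y + p
    above x y = begin-strict
      g x y * p     ≤⟨ *-monoˡ-≤ p (g≤u x y) ⟩
      u x y * p     ≤⟨ m/n*n≤m (f x y + p-1) p ⟩
      f x y + p-1   <⟨ +-monoʳ-< (f x y) (n<1+n p-1) ⟩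
      f x y + p     ∎
    below : ∀ x y → f x y < g x y * p + p
    below x y = begin-strict
      f x y                       ≡⟨ m≡m%n+[m/n]*n (f x y) p ⟩
      f x y % p + l x y * p       <⟨ +-monoˡ-< _ (m%n<n (f x y) p) ⟩
      p + l x y * p               ≡⟨ +-comm p _ ⟩
      l x y * p + p               ≤⟨ +-monoˡ-≤ p (*-monoˡ-≤ p (l≤g x y)) ⟩
      g x y * p + p               ∎

-- Rounding a matrix together with its row, column and class sums

-- Each quantity to be rounded is the flow on one arc: row sums leave `root`, entries go from `row`
-- to `cls`, class sums from `cls` to `column`, and column sums return to `root`. The classes depend
-- on the colour, hence the two indices of `cls`.
module RoundingNetwork (m k M : ℕ) (κ : Fin m → Fin k → Fin M) where

  data Node : Set where
    root : Node
    row  : Fin m → Node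
    cls  : Fin k → Fin M → Node
    column : Fin k → Node

  size : ℕ
  size = suc (m + (k * M + k))

  code : Node → Fin size
  code root      = F.zero
  code (row v)   = F.suc (v ↑ˡ (k * M + k))
  code (cls j i) = F.suc (m ↑ʳ (combine j i ↑ˡ k))
  code (column j)   = F.suc (m ↑ʳ (k * M ↑ʳ j))

  decode₂ : Fin (k * M) ⊎ Fin k → Node
  decode₂ (inj₁ c) = uncurry cls (remQuot M c)
  decode₂ (inj₂ j) = column j

  decode₁ : Fin m ⊎ Fin (k * M + k) → Node
  decode₁ (inj₁ v) = row v
  decode₁ (inj₂ y) = decode₂ (splitAt (k * M) y)

  decode : Fin size → Node
  decode F.zero    = root
  decode (F.suc x) = decode₁ (splitAt m x)

  decode-code : ∀ a → decode (code a) ≡ a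
  decode-code root       = refl
  decode-code (row v)    = cong decode₁ (splitAt-↑ˡ m v (k * M + k))
  decode-code (cls j i)  =
    trans (cong decode₁ (splitAt-↑ʳ m (k * M + k) (combine j i ↑ˡ k)))
    (trans (cong decode₂ (splitAt-↑ˡ (k * M) (combine j i) k))
           (cong (uncurry cls) (remQuot-combine {k} {M} j i)))
  decode-code (column j) =
    trans (cong decode₁ (splitAt-↑ʳ m (k * M + k) (k * M ↑ʳ j)))
          (cong decode₂ (splitAt-↑ʳ (k * M) k j))

  sumNode : (Node → ℕ) → ℕ
  sumNode h = h root + (sumFin (λ v → h (row v)) +
    (sumFin (λ j → sumFin (λ i → h (cls j i))) + sumFin (λ j → h (column j))))

  sum-code : ∀ h → sumFin h ≡ sumNode (λ a → h (code a))
  sum-code h = cong (h F.zero +_) (trans (sum-↑ m _) (cong (sumFin (λ v → h (code (row v))) +_)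
    (trans (sum-↑ (k * M) _) (cong (_+ sumFin (λ j → h (code (column j)))) (sum-combine k _)))))

  sumNode-cong : ∀ {h h′} → (∀ a → h a ≡ h′ a) → sumNode h ≡ sumNode h′
  sumNode-cong e = cong₂ _+_ (e root) (cong₂ _+_ (sum-cong (λ v → e (row v)))
    (cong₂ _+_ (sum-cong (λ j → sum-cong (λ i → e (cls j i)))) (sum-cong (λ j → e (column j)))))

  -- The arc values are parameters because the given flow and its rounding both have this shape.
  module Flow (A : Fin m → ℕ) (B : Fin m → Fin k → ℕ) (C : Fin k → Fin M → ℕ) (D : Fin k → ℕ) where

    flow : Node → Node → ℕ
    flow root      (row v)   = A v
    flow (row v)   (cls j i) = ind (κ v j ≟ᶠ i) * B v j
    flow (cls j i) (column j′)  = ind (j ≟ᶠ j′) * C j i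
    flow (column j) root      = D j
    flow _         _         = 0

    out in′ : Node → ℕ
    out a = sumNode (flow a)
    in′ a = sumNode (λ b → flow b a)

    private
      0ᵏ : sumFin {k} (λ _ → 0) ≡ 0
      0ᵏ = sum-zero {k} (λ _ → refl)
      0ᵐ : sumFin {m} (λ _ → 0) ≡ 0
      0ᵐ = sum-zero {m} (λ _ → refl)
      0ᵏᴹ : sumFin {k} (λ _ → sumFin {M} (λ _ → 0)) ≡ 0
      0ᵏᴹ = sum-zero {k} (λ _ → sum-zero {M} (λ _ → refl))

    out-root : out root ≡ sumFin A
    out-root = trans (cong (sumFin A +_) (cong₂ _+_ 0ᵏᴹ 0ᵏ)) (+-identityʳ _)

    in-root : in′ root ≡ sumFin D
    in-root = cong₂ _+_ 0ᵐ (cong (_+ sumFin D) 0ᵏᴹ)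

    out-row : ∀ v → out (row v) ≡ sumFin (B v)
    out-row v = cong₂ _+_ 0ᵐ (trans (cong₂ _+_ (sum-cong (λ j → sum-δ (κ v j) (λ _ → B v j))) 0ᵏ) (+-identityʳ _))

    in-row : ∀ v → in′ (row v) ≡ A v
    in-row v = trans (cong (A v +_) (cong₂ _+_ 0ᵐ (cong₂ _+_ 0ᵏᴹ 0ᵏ))) (+-identityʳ _)

    out-cls : ∀ j i → out (cls j i) ≡ C j i
    out-cls j i = cong₂ _+_ 0ᵐ (cong₂ _+_ 0ᵏᴹ (sum-δ j (λ _ → C j i)))

    in-cls : ∀ j i → in′ (cls j i) ≡ classSum (λ v → κ v j) (λ v → B v j) i
    in-cls j i = trans (cong (classSum (λ v → κ v j) (λ v → B v j) i +_) (cong₂ _+_ 0ᵏᴹ 0ᵏ)) (+-identityʳ _)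

    out-col : ∀ j → out (column j) ≡ D j
    out-col j = trans (cong (D j +_) (cong₂ _+_ 0ᵐ (cong₂ _+_ 0ᵏᴹ 0ᵏ))) (+-identityʳ _)

    in-col : ∀ j → in′ (column j) ≡ sumFin (C j)
    in-col j = cong₂ _+_ 0ᵐ (trans (cong₂ _+_ one 0ᵏ) (+-identityʳ _))
      where
      one : sumFin (λ j′ → sumFin (λ i → ind (j′ ≟ᶠ j) * C j′ i)) ≡ sumFin (C j)
      one = trans (sum-cong (λ j′ → trans (sum-*ˡ (ind (j′ ≟ᶠ j)) (C j′)) (cong (_* sumFin (C j′)) (ind-sym j′ j))))
                  (sum-δ j (λ j′ → sumFin (C j′)))

module _ (m k M lam p : ℕ) .{{_ : NonZero p}} (κ : Fin m → Fin k → Fin M)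
         (d : Fin m → Fin k → ℕ) (rows : ∀ v → sumFin (d v) ≡ lam * p) where

  open RoundingNetwork m k M κ

  private
    <+p⇒≤ : ∀ {a b} → a * p < b * p + p → a ≤ b
    <+p⇒≤ {a} {b} lt = s≤s⁻¹ (*-cancelʳ-< p a (suc b) (subst (a * p <_) (+-comm (b * p) p) lt))

  record Rounding : Set where
    field
      x          : Fin m → Fin k → ℕ
      entry-≤    : ∀ v j → x v j ≤ d v j
      row-sum    : ∀ v → sumFin (x v) ≡ lam
      class-<    : ∀ j i → classSum (λ v → κ v j) (λ v → x v j) i * p
                           < classSum (λ v → κ v j) (λ v → d v j) i + p
      column-<   : ∀ j → sumFin (λ v → x v j) * p < sumFin (λ v → d v j) + p
      column->   : ∀ j → sumFin (λ v → d v j) < sumFin (λ v → x v j) * p + p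

  round : Rounding
  round = record
    { x = x′ ; entry-≤ = entry′ ; row-sum = row-sum′
    ; class-< = λ j i → subst (λ c → c * p < C j i + p) (sym (class-sum′ j i)) (C-< j i)
    ; column-< = λ j → subst (λ s → s * p < D j + p) (sym (column-sum′ j)) (proj₁ (rounds (column j) root))
    ; column-> = λ j → subst (λ s → D j < s * p + p) (sym (column-sum′ j)) (proj₂ (rounds (column j) root)) }
    where
    C : Fin k → Fin M → ℕ
    C j i = classSum (λ v → κ v j) (λ v → d v j) i
    D : Fin k → ℕ
    D j = sumFin (λ v → d v j)
    module f = Flow (λ _ → lam * p) d C D
    balanced : ∀ a → f.out a ≡ f.in′ a
    balanced root = trans f.out-root (trans (trans (sum-cong (λ v → sym (rows v))) (sum-swap d)) (sym f.in-root))
    balanced (row v) = trans (f.out-row v) (trans (rows v) (sym (f.in-row v)))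
    balanced (cls j i) = trans (f.out-cls j i) (sym (f.in-cls j i))
    balanced (column j) = trans (f.out-col j)
      (trans (sym (sum-classSum (λ v → κ v j) (λ v → d v j))) (sym (f.in-col j)))
    f : Matrix size
    f x y = f.flow (decode x) (decode y)
    f-conserved : Conserved f
    f-conserved x = begin
      sumFin (f x)                       ≡⟨ sum-code (f x) ⟩
      sumNode (λ b → f x (code b))       ≡⟨ sumNode-cong (λ b → cong (f.flow (decode x)) (decode-code b)) ⟩
      f.out (decode x)                   ≡⟨ balanced (decode x) ⟩
      f.in′ (decode x)                   ≡⟨ sumNode-cong (λ b → cong (λ a → f.flow a (decode x)) (decode-code b)) ⟨
      sumNode (λ b → f (code b) x)       ≡⟨ sum-code (λ y → f y x) ⟨
      sumFin (λ y → f y x)               ∎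
      where open ≡-Reasoning
    rounded = round-circulation p f f-conserved
    g : Node → Node → ℕ
    g a b = proj₁ rounded (code a) (code b)
    rounds : ∀ a b → (g a b * p < f.flow a b + p) × (f.flow a b < g a b * p + p)
    rounds a b = subst (λ c → (g a b * p < c + p) × (c < g a b * p + p))
      (cong₂ f.flow (decode-code a) (decode-code b))
      (proj₁ (proj₂ rounded) (code a) (code b) , proj₁ (proj₂ (proj₂ rounded)) (code a) (code b))
    -- Where the given flow is zero, its rounding satisfies g p < p and vanishes. So no flow appears
    -- outside the network, and `g` is again a `Flow`.
    g≡0 : ∀ a b → f.flow a b ≡ 0 → g a b ≡ 0
    g≡0 a b e = n≤0⇒n≡0 (<+p⇒≤ {g a b} {0} (subst (λ c → g a b * p < c + p) e (proj₁ (rounds a b))))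
    x′ : Fin m → Fin k → ℕ
    x′ v j = g (row v) (cls j (κ v j))
    module g = Flow (λ v → g root (row v)) x′ (λ j i → g (cls j i) (column j)) (λ j → g (column j) root)
    g≡flow : ∀ a b → g a b ≡ g.flow a b
    g≡flow root (row v) = refl
    g≡flow (row v) (cls j i) with κ v j ≟ᶠ i in e
    ... | yes refl = sym (*-identityˡ _)
    ... | no _     = g≡0 (row v) (cls j i) (cong (λ c → ind c * d v j) e)
    g≡flow (cls j i) (column j′) with j ≟ᶠ j′ in e
    ... | yes refl = sym (*-identityˡ _)
    ... | no _     = g≡0 (cls j i) (column j′) (cong (λ c → ind c * C j i) e)
    g≡flow (column j) root = refl
    g≡flow root root = g≡0 root root refl
    g≡flow root (cls j i) = g≡0 root (cls j i) refl
    g≡flow root (column j) = g≡0 root (column j) refl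
    g≡flow (row v) root = g≡0 (row v) root refl
    g≡flow (row v) (row w) = g≡0 (row v) (row w) refl
    g≡flow (row v) (column j) = g≡0 (row v) (column j) refl
    g≡flow (cls j i) root = g≡0 (cls j i) root refl
    g≡flow (cls j i) (row v) = g≡0 (cls j i) (row v) refl
    g≡flow (cls j i) (cls j′ i′) = g≡0 (cls j i) (cls j′ i′) refl
    g≡flow (column j) (row v) = g≡0 (column j) (row v) refl
    g≡flow (column j) (cls j′ i) = g≡0 (column j) (cls j′ i) refl
    g≡flow (column j) (column j′) = g≡0 (column j) (column j′) refl
    g-balanced : ∀ a → g.out a ≡ g.in′ a
    g-balanced a = begin
      g.out a                                      ≡⟨ sumNode-cong (g≡flow a) ⟨
      sumNode (g a)                                ≡⟨ sum-code (proj₁ rounded (code a)) ⟨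
      sumFin (proj₁ rounded (code a))              ≡⟨ proj₂ (proj₂ (proj₂ rounded)) (code a) ⟩
      sumFin (λ y → proj₁ rounded y (code a))      ≡⟨ sum-code (λ y → proj₁ rounded y (code a)) ⟩
      sumNode (λ b → g b a)                        ≡⟨ sumNode-cong (λ b → g≡flow b a) ⟩
      g.in′ a                                      ∎
      where open ≡-Reasoning
    ind-self : ∀ {N} (i : Fin N) c → ind (i ≟ᶠ i) * c ≡ c
    ind-self i c = trans (cong (_* c) (ind-yes (i ≟ᶠ i) refl)) (*-identityˡ c)
    entry′ : ∀ v j → x′ v j ≤ d v j
    entry′ v j = <+p⇒≤ (<-≤-trans
      (subst (λ c → x′ v j * p < c + p) (ind-self (κ v j) (d v j)) (proj₁ (rounds (row v) (cls j (κ v j)))))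
      (+-monoˡ-≤ p (m≤m*n (d v j) p)))
    -- The arc from `root` to a row carries `lam * p`, a multiple of `p`, so it rounds to exactly
    -- `lam`.
    row-sum′ : ∀ v → sumFin (x′ v) ≡ lam
    row-sum′ v = trans (sym (g.out-row v)) (trans (g-balanced (row v)) (trans (g.in-row v)
      (≤-antisym (<+p⇒≤ (proj₁ (rounds root (row v)))) (<+p⇒≤ (proj₂ (rounds root (row v)))))))
    C-< : ∀ j i → g (cls j i) (column j) * p < C j i + p
    C-< j i = subst (λ c → g (cls j i) (column j) * p < c + p) (ind-self j (C j i)) (proj₁ (rounds (cls j i) (column j)))
    class-sum′ : ∀ j i → classSum (λ v → κ v j) (λ v → x′ v j) i ≡ g (cls j i) (column j)
    class-sum′ j i = trans (sym (g.in-cls j i)) (trans (sym (g-balanced (cls j i))) (g.out-cls j i))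
    column-sum′ : ∀ j → sumFin (λ v → x′ v j) ≡ g (column j) root
    column-sum′ j = trans (sym (sum-classSum (λ v → κ v j) (λ v → x′ v j)))
      (trans (sum-cong (class-sum′ j)) (trans (sym (g.in-col j)) (trans (sym (g-balanced (column j))) (g.out-col j))))

-- Colour classes and their components when a vertex is added

module _ (χ : EdgeColouring N lam k) where

  mult : Fin k → Fin N → Fin N → ℕ
  mult j u v = sumFin (λ c → ind (col χ u v c ≟ᶠ j))

  mult-sym : ∀ j u v → mult j u v ≡ mult j v u
  mult-sym j u v = sum-cong (λ c → cong (λ i → ind (i ≟ᶠ j)) (EdgeColouring.sym χ u v c))

  deg-mult : ∀ v j → deg χ v j ≡ sumFin (λ w → ind (¬? (w ≟ᶠ v)) * mult j w v)
  deg-mult v j = sum-cong (λ w →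
    trans (sum-cong (λ c → ind-× (¬? (w ≟ᶠ v)) (col χ w v c ≟ᶠ j)))
          (sum-*ˡ (ind (¬? (w ≟ᶠ v))) (λ c → ind (col χ w v c ≟ᶠ j))))

  edges-mult : ∀ j → edges χ j ≡ sumFin (λ u → sumFin (λ v → ind (u <ᶠ? v) * mult j u v))
  edges-mult j = sum-cong (λ u → sum-cong (λ v →
    trans (sum-cong (λ c → ind-× (u <ᶠ? v) (col χ u v c ≟ᶠ j)))
          (sum-*ˡ (ind (u <ᶠ? v)) (λ c → ind (col χ u v c ≟ᶠ j)))))

  handshake : ∀ j → sumFin (λ v → deg χ v j) ≡ 2 * edges χ j
  handshake j = begin
    sumFin (λ v → deg χ v j)
      ≡⟨ sum-cong (λ v → trans (deg-mult v j) (sum-cong (λ w → cong₂ _*_ (split v w) (mult-sym j w v)))) ⟩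
    sumFin (λ v → sumFin (λ w → (ind (v <ᶠ? w) + ind (w <ᶠ? v)) * mult j v w))
      ≡⟨ sum-cong (λ v → trans (sum-cong (λ w → *-distribʳ-+ (mult j v w) (ind (v <ᶠ? w)) (ind (w <ᶠ? v))))
                               (sum-+ (λ w → ind (v <ᶠ? w) * mult j v w) (λ w → ind (w <ᶠ? v) * mult j v w))) ⟩
    sumFin (λ v → sumFin (λ w → ind (v <ᶠ? w) * mult j v w) + sumFin (λ w → ind (w <ᶠ? v) * mult j v w))
      ≡⟨ sum-+ (λ v → sumFin (λ w → ind (v <ᶠ? w) * mult j v w)) (λ v → sumFin (λ w → ind (w <ᶠ? v) * mult j v w)) ⟩
    E + sumFin (λ v → sumFin (λ w → ind (w <ᶠ? v) * mult j v w))
      ≡⟨ cong (E +_) (trans (sum-swap (λ v w → ind (w <ᶠ? v) * mult j v w))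
           (sum-cong (λ w → sum-cong (λ v → cong (ind (w <ᶠ? v) *_) (mult-sym j v w))))) ⟩
    E + E
      ≡⟨ cong₂ _+_ (edges-mult j) (trans (+-identityʳ _) (edges-mult j)) ⟨
    2 * edges χ j ∎
    where
    open ≡-Reasoning
    E : ℕ
    E = sumFin (λ u → sumFin (λ v → ind (u <ᶠ? v) * mult j u v))
    split : ∀ v w → ind (¬? (w ≟ᶠ v)) ≡ ind (v <ᶠ? w) + ind (w <ᶠ? v)
    split v w with <ᶠ-cmp v w
    ... | tri< v<w v≢w w≮v = trans (ind-yes (¬? (w ≟ᶠ v)) (v≢w ∘ sym))
                               (sym (cong₂ _+_ (ind-yes (v <ᶠ? w) v<w) (ind-no (w <ᶠ? v) w≮v)))
    ... | tri≈ v≮w v≡w w≮v = trans (ind-no (¬? (w ≟ᶠ v)) (λ w≢v → w≢v (sym v≡w)))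
                               (sym (cong₂ _+_ (ind-no (v <ᶠ? w) v≮w) (ind-no (w <ᶠ? v) w≮v)))
    ... | tri> v≮w v≢w w<v = trans (ind-yes (¬? (w ≟ᶠ v)) (v≢w ∘ sym))
                               (sym (cong₂ _+_ (ind-no (v <ᶠ? w) v≮w) (ind-yes (w <ᶠ? v) w<v)))

  -- The summand `lam` on the left stands for the absent loops at `v` and avoids subtraction.
  sum-deg : ∀ v → sumFin (deg χ v) + lam ≡ N * lam
  sum-deg v = begin
    sumFin (deg χ v) + lam
      ≡⟨ cong₂ _+_ (trans (sum-cong (deg-mult v)) (sum-swap (λ j w → ind (¬? (w ≟ᶠ v)) * mult j w v)))
                   (sym (sum-δ v (λ _ → lam))) ⟩
    sumFin (λ w → sumFin (λ j → ind (¬? (w ≟ᶠ v)) * mult j w v)) + sumFin (λ w → ind (v ≟ᶠ w) * lam)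
      ≡⟨ cong (_+ sumFin (λ w → ind (v ≟ᶠ w) * lam))
           (sum-cong (λ w → trans (sum-*ˡ (ind (¬? (w ≟ᶠ v))) (λ j → mult j w v))
                                  (cong (ind (¬? (w ≟ᶠ v)) *_) (sum-mult w)))) ⟩
    sumFin (λ w → ind (¬? (w ≟ᶠ v)) * lam) + sumFin (λ w → ind (v ≟ᶠ w) * lam)
      ≡⟨ sum-+ (λ w → ind (¬? (w ≟ᶠ v)) * lam) (λ w → ind (v ≟ᶠ w) * lam) ⟨
    sumFin (λ w → ind (¬? (w ≟ᶠ v)) * lam + ind (v ≟ᶠ w) * lam)
      ≡⟨ sum-cong complementary ⟩
    sumFin {N} (λ _ → lam)
      ≡⟨ sum-const N lam ⟩
    N * lam ∎
    where
    open ≡-Reasoning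
    sum-mult : ∀ w → sumFin (λ j → mult j w v) ≡ lam
    sum-mult w = begin
      sumFin (λ j → mult j w v)                                   ≡⟨ sum-swap (λ j c → ind (col χ w v c ≟ᶠ j)) ⟩
      sumFin (λ c → sumFin (λ j → ind (col χ w v c ≟ᶠ j)))
        ≡⟨ sum-cong (λ c → trans (sum-cong (λ j → sym (*-identityʳ (ind (col χ w v c ≟ᶠ j))))) (sum-δ (col χ w v c) (λ _ → 1))) ⟩
      sumFin {lam} (λ _ → 1)                                      ≡⟨ trans (sum-const lam 1) (*-identityʳ lam) ⟩
      lam ∎
    complementary : ∀ w → ind (¬? (w ≟ᶠ v)) * lam + ind (v ≟ᶠ w) * lam ≡ lam
    complementary w with w ≟ᶠ v
    ... | yes refl = trans (cong (_* lam) (ind-yes (v ≟ᶠ v) refl)) (*-identityˡ lam)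
    ... | no w≢v   = trans (cong₂ _+_ (*-identityˡ lam) (cong (_* lam) (ind-no (v ≟ᶠ w) (w≢v ∘ sym)))) (+-identityʳ lam)

  mult-pos⇒∃ : ∀ {j u v} → 0 < mult j u v → ∃ λ c → col χ u v c ≡ j
  mult-pos⇒∃ {j} {u} {v} s with sum-pos⇒∃ (λ c → ind (col χ u v c ≟ᶠ j)) s
  ... | c , t = c , ind-pos (col χ u v c ≟ᶠ j) t

  ∃⇒mult-pos : ∀ {j u v} → (∃ λ c → col χ u v c ≡ j) → 0 < mult j u v
  ∃⇒mult-pos {j} {u} {v} (c , e) =
    ≤-trans (≤-reflexive (sym (ind-yes (col χ u v c ≟ᶠ j) e))) (term≤sum (λ c → ind (col χ u v c ≟ᶠ j)) c)

  adj-sym : ∀ {j u v} → Adj χ j u v → Adj χ j v u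
  adj-sym {j} {u} {v} (u≢v , c , e) = u≢v ∘ sym , c , trans (EdgeColouring.sym χ v u c) e

  reach-trans : ∀ {j u v w} → Reach χ j u v → Reach χ j v w → Reach χ j u w
  reach-trans p here       = p
  reach-trans p (step q a) = step (reach-trans p q) a

  reach-sym : ∀ {j u v} → Reach χ j u v → Reach χ j v u
  reach-sym here       = here
  reach-sym (step p a) = reach-trans (step here (adj-sym a)) (reach-sym p)

degSum : EdgeColouring m lam k → Fin k → ℕ
degSum χ j = sumFin (λ v → deg χ v j)

record Labelling (χ : EdgeColouring N lam k) (j : Fin k) (M : ℕ) : Set where
  field
    label  : Fin N → Fin M
    joined : ∀ u v → label u ≡ label v → Reach χ j u v
    closed : ∀ u v → Adj χ j u v → label u ≡ label v

  constant : ∀ {u v} → Reach χ j u v → label u ≡ label v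
  constant here       = refl
  constant (step p a) = trans (constant p) (closed _ _ a)

  size : Fin M → ℕ
  size = classSum label (λ _ → 1)

  components : ℕ
  components = sumFin (λ i → pos (size i))


open Labelling

_◁_ : EdgeColouring m lam k → EdgeColouring (suc m) lam k → Set
χ ◁ χ′ = ∀ u v c → u ≢ v → col χ′ (inject₁ u) (inject₁ v) c ≡ col χ u v c

snoc : {A : Set} → (Fin m → A) → A → Fin (suc m) → A
snoc {zero}  f a _         = a
snoc {suc m} f a F.zero    = f F.zero
snoc {suc m} f a (F.suc i) = snoc (λ i → f (F.suc i)) a i

snoc-inject₁ : {A : Set} (f : Fin m → A) (a : A) (i : Fin m) → snoc f a (inject₁ i) ≡ f i
snoc-inject₁ {suc m} f a F.zero    = refl
snoc-inject₁ {suc m} f a (F.suc i) = snoc-inject₁ (λ i → f (F.suc i)) a i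

snoc-fromℕ : {A : Set} (f : Fin m → A) (a : A) → snoc f a (fromℕ m) ≡ a
snoc-fromℕ {zero}  f a = refl
snoc-fromℕ {suc m} f a = snoc-fromℕ (λ i → f (F.suc i)) a

module AddVertex (χ : EdgeColouring m lam k) (χ′ : EdgeColouring (suc m) lam k) (χ◁χ′ : χ ◁ χ′) (j : Fin k) where

  new : Fin m → ℕ
  new v = mult χ′ j (fromℕ m) (inject₁ v)

  deg-old : ∀ v → deg χ′ (inject₁ v) j ≡ deg χ v j + new v
  deg-old v = trans (sum-last (λ w → sumFin (λ c → ind (¬? (w ≟ᶠ inject₁ v) ×-dec (col χ′ w (inject₁ v) c ≟ᶠ j)))))
    (cong₂ _+_
      (sum-cong (λ w → sum-cong (λ c →
        ind-⇔ (¬? (inject₁ w ≟ᶠ inject₁ v) ×-dec (col χ′ (inject₁ w) (inject₁ v) c ≟ᶠ j))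
              (¬? (w ≟ᶠ v) ×-dec (col χ w v c ≟ᶠ j))
              (λ { (w≢v , e) → w≢v ∘ cong inject₁ , trans (sym (χ◁χ′ w v c (w≢v ∘ cong inject₁))) e })
              (λ { (w≢v , e) → w≢v ∘ inject₁-injective , trans (χ◁χ′ w v c w≢v) e }))))
      (sum-cong (λ c →
        ind-⇔ (¬? (fromℕ m ≟ᶠ inject₁ v) ×-dec (col χ′ (fromℕ m) (inject₁ v) c ≟ᶠ j))
              (col χ′ (fromℕ m) (inject₁ v) c ≟ᶠ j)
              proj₂ (fromℕ≢inject₁ ,_))))

  deg-new : deg χ′ (fromℕ m) j ≡ sumFin new
  deg-new = trans (deg-mult χ′ (fromℕ m) j)
    (trans (sum-last (λ w → ind (¬? (w ≟ᶠ fromℕ m)) * mult χ′ j w (fromℕ m)))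
    (trans (cong₂ _+_
      (sum-cong (λ v → trans (cong₂ _*_ (ind-yes (¬? (inject₁ v ≟ᶠ fromℕ m)) (≢-sym fromℕ≢inject₁)) (mult-sym χ′ j (inject₁ v) (fromℕ m)))
                             (*-identityˡ (new v))))
      (cong (_* mult χ′ j (fromℕ m) (fromℕ m)) (ind-no (¬? (fromℕ m ≟ᶠ fromℕ m)) (λ ne → ne refl))))
    (+-identityʳ (sumFin new))))

  sum-deg-grow : degSum χ′ j ≡ degSum χ j + 2 * sumFin new
  sum-deg-grow = trans (sum-last (λ v → deg χ′ v j))
    (trans (cong₂ _+_ (trans (sum-cong deg-old) (sum-+ (λ v → deg χ v j) new)) deg-new)
           (double (degSum χ j) (sumFin new)))
    where
    double : ∀ a b → a + b + b ≡ a + 2 * b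
    double = solve-∀

  adj-lift : ∀ {u v} → Adj χ j u v → Adj χ′ j (inject₁ u) (inject₁ v)
  adj-lift (u≢v , c , e) = u≢v ∘ inject₁-injective , c , trans (χ◁χ′ _ _ c u≢v) e

  adj-lower : ∀ {u v} → Adj χ′ j (inject₁ u) (inject₁ v) → Adj χ j u v
  adj-lower (u≢v , c , e) = u≢v ∘ cong inject₁ , c , trans (sym (χ◁χ′ _ _ c (u≢v ∘ cong inject₁))) e

  reach-lift : ∀ {u v} → Reach χ j u v → Reach χ′ j (inject₁ u) (inject₁ v)
  reach-lift here       = here
  reach-lift (step p a) = step (reach-lift p) (adj-lift a)

  new-pos⇒adj : ∀ {v} → 0 < new v → Adj χ′ j (fromℕ m) (inject₁ v)
  new-pos⇒adj s = fromℕ≢inject₁ , mult-pos⇒∃ χ′ s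

  adj⇒new-pos : ∀ {v} → Adj χ′ j (fromℕ m) (inject₁ v) → 0 < new v
  adj⇒new-pos (_ , a) = ∃⇒mult-pos χ′ a

  module Relabel (L : Labelling χ j M) where

    touch : Fin M → ℕ
    touch = classSum (label L) new

    -- Label zero is reserved for the component of the new vertex, which absorbs every class with an
    -- edge to it.
    merge : ℕ → Fin M → Fin (suc M)
    merge zero    i = F.suc i
    merge (suc _) i = F.zero

    merge-pos : ∀ {t i} → 0 < t → merge t i ≡ F.zero
    merge-pos {suc _} _ = refl

    relabel : Fin M → Fin (suc M)
    relabel i = merge (touch i) i

    label′ : Fin (suc m) → Fin (suc M)
    label′ = snoc (relabel ∘ label L) F.zero

    label-old : ∀ v → label′ (inject₁ v) ≡ relabel (label L v)
    label-old = snoc-inject₁ (relabel ∘ label L) F.zero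

    label-new : label′ (fromℕ m) ≡ F.zero
    label-new = snoc-fromℕ (relabel ∘ label L) F.zero

    new-pos⇒merged : ∀ {v} → 0 < new v → relabel (label L v) ≡ F.zero
    new-pos⇒merged {v} s = merge-pos (<-≤-trans s (term≤classSum (label L) new v))

    relabel≡0⇒touched : ∀ {i} → relabel i ≡ F.zero → 0 < touch i
    relabel≡0⇒touched {i} e with touch i
    ... | suc _ = s≤s z≤n

    relabel-suc : ∀ {i i′} → relabel i ≡ F.suc i′ → i ≡ i′ × touch i ≡ 0
    relabel-suc {i} e with touch i
    relabel-suc refl | zero = refl , refl

    reach-new : ∀ {v} → relabel (label L v) ≡ F.zero → Reach χ′ j (fromℕ m) (inject₁ v)
    reach-new {v} e with classSum-pos⇒∃ (label L) new (label L v) (relabel≡0⇒touched e)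
    ... | u , ℓu≡ℓv , s = reach-trans χ′ (step here (new-pos⇒adj s)) (reach-lift (joined L u v ℓu≡ℓv))

    joined-old : ∀ u v → relabel (label L u) ≡ relabel (label L v) → Reach χ′ j (inject₁ u) (inject₁ v)
    joined-old u v e with relabel (label L u) in eu
    ... | F.zero  = reach-trans χ′ (reach-sym χ′ (reach-new eu)) (reach-new (sym e))
    ... | F.suc _ = reach-lift (joined L u v (trans (proj₁ (relabel-suc eu)) (sym (proj₁ (relabel-suc (sym e))))))

    joined′ : ∀ u v → label′ u ≡ label′ v → Reach χ′ j u v
    joined′ u v e with view u | view v
    ... | ‵fromℕ     | ‵fromℕ     = here
    ... | ‵fromℕ     | ‵inject₁ v = reach-new (trans (sym (label-old v)) (trans (sym e) label-new))
    ... | ‵inject₁ u | ‵fromℕ     = reach-sym χ′ (reach-new (trans (sym (label-old u)) (trans e label-new)))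
    ... | ‵inject₁ u | ‵inject₁ v = joined-old u v (trans (sym (label-old u)) (trans e (label-old v)))

    closed′ : ∀ u v → Adj χ′ j u v → label′ u ≡ label′ v
    closed′ u v a with view u | view v
    ... | ‵fromℕ     | ‵fromℕ     = refl
    ... | ‵fromℕ     | ‵inject₁ v = trans label-new (sym (trans (label-old v) (new-pos⇒merged (adj⇒new-pos a))))
    ... | ‵inject₁ u | ‵fromℕ     = trans (label-old u) (trans (new-pos⇒merged (adj⇒new-pos (adj-sym χ′ a))) (sym label-new))
    ... | ‵inject₁ u | ‵inject₁ v = trans (label-old u) (trans (cong relabel (closed L u v (adj-lower a))) (sym (label-old v)))

    labelling′ : Labelling χ′ j (suc M)
    labelling′ = record { label = label′ ; joined = joined′ ; closed = closed′ }

    touched : ℕ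
    touched = sumFin (λ i → pos (touch i))

    touched≤new : touched ≤ sumFin new
    touched≤new = ≤-trans (sum-mono (λ i → pos≤ (touch i))) (≤-reflexive (sum-classSum (label L) new))

    size′-zero : pos (size labelling′ F.zero) ≡ 1
    size′-zero = pos-≡1 (subst (λ i → 0 < size labelling′ i) label-new (term≤classSum label′ (λ _ → 1) (fromℕ m)))

    size′-suc : ∀ i → pos (size labelling′ (F.suc i)) + pos (touch i) ≡ pos (size L i)
    size′-suc i = trans (cong (λ s → pos s + pos (touch i)) old-part) (by-touch (touch i) refl)
      where
      old-part : size labelling′ (F.suc i) ≡ sumFin (λ v → ind (relabel (label L v) ≟ᶠ F.suc i) * 1)
      old-part = trans (sum-last (λ v → ind (label′ v ≟ᶠ F.suc i) * 1))
        (trans (cong₂ _+_ (sum-cong (λ v → cong (λ l → ind (l ≟ᶠ F.suc i) * 1) (label-old v)))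
                          (cong (λ l → ind (l ≟ᶠ F.suc i) * 1) label-new))
               (+-identityʳ _))
      by-touch : ∀ t → touch i ≡ t → pos (sumFin (λ v → ind (relabel (label L v) ≟ᶠ F.suc i) * 1)) + pos t ≡ pos (size L i)
      by-touch zero e = trans (+-identityʳ _) (cong pos (sum-cong (λ v → cong (_* 1)
        (ind-⇔ (relabel (label L v) ≟ᶠ F.suc i) (label L v ≟ᶠ i) (λ r → proj₁ (relabel-suc r))
               (λ { refl → cong (λ t → merge t i) e })))))
      by-touch (suc t) e with classSum-pos⇒∃ (label L) new i (subst (0 <_) (sym e) (s≤s z≤n))
      ... | u , refl , _ = trans
        (cong (λ s → pos s + 1) (sum-zero (λ v → cong (_* 1) (ind-no (relabel (label L v) ≟ᶠ F.suc i)
          (λ r → contradiction (trans (sym e) (trans (cong touch (sym (proj₁ (relabel-suc r)))) (proj₂ (relabel-suc r)))) λ ())))))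
        (sym (pos-≡1 (term≤classSum (label L) (λ _ → 1) u)))

    -- By `size′-suc` a nonempty old class survives exactly if it is untouched; label zero, always
    -- in use for the new vertex, adds one.
    components-grow : components labelling′ + touched ≡ suc (components L)
    components-grow = trans
      (cong (λ z → z + sumFin (λ i → pos (size labelling′ (F.suc i))) + touched) size′-zero)
      (cong suc (trans (sym (sum-+ (λ i → pos (size labelling′ (F.suc i))) (λ i → pos (touch i)))) (sum-cong size′-suc)))

-- Building labellings and colourings one vertex at a time

shrink : EdgeColouring (suc m) lam k → EdgeColouring m lam k
shrink χ = record { col = λ u v → col χ (inject₁ u) (inject₁ v) ; sym = λ u v → EdgeColouring.sym χ (inject₁ u) (inject₁ v) }

-- Components are found without deciding reachability: from the empty graph on, each new vertex
-- merges the components that it touches.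
labelling : (χ : EdgeColouring m lam k) (j : Fin k) → Labelling χ j m
labelling {zero}  χ j = record { label = λ () ; joined = λ () ; closed = λ () }
labelling {suc m} χ j = AddVertex.Relabel.labelling′ (shrink χ) χ (λ _ _ _ _ → refl) j (labelling (shrink χ) j)

module Grow (χ : EdgeColouring m lam k) (f : Fin m → Fin lam → Fin k) (i₀ : Fin k) where

  private
    old-row : Fin m → Fin (suc m) → Fin lam → Fin k
    old-row u v c = snoc (λ v → col χ u v c) (f u c) v

    -- `i₀` fills the diagonal entry of the new vertex, which has no meaning.
    new-row : Fin (suc m) → Fin lam → Fin k
    new-row v c = snoc (λ v → f v c) i₀ v

    col′ : Fin (suc m) → Fin (suc m) → Fin lam → Fin k
    col′ u v c = snoc (λ u → old-row u v c) (new-row v c) u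

    old-old : ∀ u v c → col′ (inject₁ u) (inject₁ v) c ≡ col χ u v c
    old-old u v c = trans (snoc-inject₁ (λ u → old-row u (inject₁ v) c) (new-row (inject₁ v) c) u)
                          (snoc-inject₁ (λ v → col χ u v c) (f u c) v)

    old-new : ∀ u c → col′ (inject₁ u) (fromℕ m) c ≡ f u c
    old-new u c = trans (snoc-inject₁ (λ u → old-row u (fromℕ m) c) (new-row (fromℕ m) c) u)
                        (snoc-fromℕ (λ v → col χ u v c) (f u c))

    new-old : ∀ v c → col′ (fromℕ m) (inject₁ v) c ≡ f v c
    new-old v c = trans (snoc-fromℕ (λ u → old-row u (inject₁ v) c) (new-row (inject₁ v) c))
                        (snoc-inject₁ (λ v → f v c) i₀ v)

    sym′ : ∀ u v c → col′ u v c ≡ col′ v u c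
    sym′ u v c with view u | view v
    ... | ‵fromℕ     | ‵fromℕ     = refl
    ... | ‵fromℕ     | ‵inject₁ v = trans (new-old v c) (sym (old-new v c))
    ... | ‵inject₁ u | ‵fromℕ     = trans (old-new u c) (sym (new-old u c))
    ... | ‵inject₁ u | ‵inject₁ v = trans (old-old u v c) (trans (EdgeColouring.sym χ u v c) (sym (old-old v u c)))

  grow : EdgeColouring (suc m) lam k
  grow = record { col = col′ ; sym = sym′ }

  ◁-grow : χ ◁ grow
  ◁-grow u v c _ = old-old u v c

  mult-grow : ∀ j v → mult grow j (fromℕ m) (inject₁ v) ≡ sumFin (λ c → ind (f v c ≟ᶠ j))
  mult-grow j v = sum-cong (λ c → cong (λ i → ind (i ≟ᶠ j)) (new-old v c))

-- Turns multiplicities into colours of parallel edges: the first copy takes a colour of positive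
-- multiplicity, which is then lowered by one.
distribute : ∀ lam (x : Fin k → ℕ) → sumFin x ≡ lam → ∃ λ (f : Fin lam → Fin k) → ∀ j → sumFin (λ c → ind (f c ≟ᶠ j)) ≡ x j
distribute zero x s = (λ ()) , λ j → sym (n≤0⇒n≡0 (subst (x j ≤_) s (term≤sum x j)))
distribute {k} (suc lam) x s with sum-pos⇒∃ x (subst (0 <_) (sym s) (s≤s z≤n))
... | i , xᵢ>0 = f , λ j → trans (cong (ind (i ≟ᶠ j) +_) (proj₂ rec j)) (x≡ind+y j)
  where
  y : Fin k → ℕ
  y j = x j ∸ ind (i ≟ᶠ j)
  x≡ind+y : ∀ j → ind (i ≟ᶠ j) + y j ≡ x j
  x≡ind+y j with i ≟ᶠ j
  ... | yes refl = m+[n∸m]≡n xᵢ>0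
  ... | no _     = refl
  sum-y : sumFin y ≡ lam
  sum-y = suc-injective (begin
    1 + sumFin y                                        ≡⟨ cong (_+ sumFin y) (sum-δ i (λ _ → 1)) ⟨
    sumFin (λ j → ind (i ≟ᶠ j) * 1) + sumFin y          ≡⟨ sum-+ (λ j → ind (i ≟ᶠ j) * 1) y ⟨
    sumFin (λ j → ind (i ≟ᶠ j) * 1 + y j)               ≡⟨ sum-cong (λ j → trans (cong (_+ y j) (*-identityʳ _)) (x≡ind+y j)) ⟩
    sumFin x                                            ≡⟨ s ⟩
    suc lam ∎)
    where open ≡-Reasoning
  rec : ∃ λ (f : Fin lam → Fin k) → ∀ j → sumFin (λ c → ind (f c ≟ᶠ j)) ≡ y j
  rec = distribute lam y sum-y
  f : Fin (suc lam) → Fin k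
  f F.zero    = i
  f (F.suc c) = proj₁ rec c

-- Labellings and component counts

used : ∀ {N M} → (Fin N → Fin M) → Fin M → ℕ
used ℓ i = pos (classSum ℓ (λ _ → 1) i)

surjective⇒used : ∀ {N M} (ℓ : Fin N → Fin M) → (∀ i → ∃ λ v → ℓ v ≡ i) → sumFin (used ℓ) ≡ M
surjective⇒used {M = M} ℓ surj = trans
  (sum-cong (λ i → pos-≡1 (subst (λ i → 0 < classSum ℓ (λ _ → 1) i) (proj₂ (surj i)) (term≤classSum ℓ (λ _ → 1) (proj₁ (surj i))))))
  (trans (sum-const M 1) (*-identityʳ M))

Compression : ∀ {N M} → (Fin N → Fin M) → ℕ → Set
Compression {N} ℓ c = Σ (Fin N → Fin c) λ ℓ′ →
  (∀ i → ∃ λ v → ℓ′ v ≡ i) × (∀ u v → (ℓ′ u ≡ ℓ′ v → ℓ u ≡ ℓ v) × (ℓ u ≡ ℓ v → ℓ′ u ≡ ℓ′ v))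

compress : ∀ {N} M (ℓ : Fin N → Fin M) → Compression ℓ (sumFin (used ℓ))
compress {N} M ℓ with any? (λ i → classSum ℓ (λ _ → 1) i ≟ 0)
... | no all-used = subst (Compression ℓ) (sym (surjective⇒used ℓ surj)) (ℓ , surj , λ u v → (λ e → e) , (λ e → e))
  where
  surj : ∀ i → ∃ λ v → ℓ v ≡ i
  surj i with classSum-pos⇒∃ ℓ (λ _ → 1) i (n≢0⇒n>0 (λ z → all-used (i , z)))
  ... | v , e , _ = v , e
compress {N} (suc M) ℓ | yes (i , unused) = subst (Compression ℓ) (sym same-count) (reduced (compress M ℓ⁻))
  where
  i≢ : ∀ v → i ≢ ℓ v
  i≢ v refl = contradiction (subst (0 <_) unused (term≤classSum ℓ (λ _ → 1) v)) λ ()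
  ℓ⁻ : Fin N → Fin M
  ℓ⁻ v = punchOut (i≢ v)
  same-count : sumFin (used ℓ) ≡ sumFin (used ℓ⁻)
  same-count = trans (sum-punchIn (used ℓ) i) (cong₂ _+_ (cong pos unused)
    (sum-cong (λ i′ → cong pos (sum-cong (λ v → cong (_* 1)
      (ind-⇔ (ℓ v ≟ᶠ punchIn i i′) (ℓ⁻ v ≟ᶠ i′)
        (λ e → trans (punchOut-cong i e) (punchOut-punchIn i {i′}))
        (λ { refl → sym (punchIn-punchOut (i≢ v)) })))))))
  reduced : Compression ℓ⁻ (sumFin (used ℓ⁻)) → Compression ℓ (sumFin (used ℓ⁻))
  reduced (ℓ′ , surj , same) = ℓ′ , surj , λ u v →
    (λ e → punchOut-injective (i≢ u) (i≢ v) (proj₁ (same u v) e)) ,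
    (λ e → proj₂ (same u v) (punchOut-cong i e))

module _ {χ : EdgeColouring m lam k} {j : Fin k} where

  componentCount : ∀ {M} (L : Labelling χ j M) → IsComponentCount χ j (components L)
  componentCount {M} L with compress M (label L)
  ... | ℓ′ , surj , same = ℓ′ , surj , λ u v →
    (λ e → joined L u v (proj₁ (same u v) e)) , (λ p → proj₂ (same u v) (constant L p))

  fromCount : ∀ {c} → IsComponentCount χ j c → Labelling χ j c
  fromCount (ℓ , _ , classes) = record
    { label = ℓ ; joined = λ u v → proj₁ (classes u v) ; closed = λ u v a → proj₂ (classes u v) (step here a) }

  components-fromCount : ∀ {c} (cc : IsComponentCount χ j c) → components (fromCount cc) ≡ c
  components-fromCount (ℓ , surj , _) = surjective⇒used ℓ surj

  components-connected : ∀ {M} (L : Labelling χ j M) → Fin m → (∀ u v → Reach χ j u v) → components L ≤ 1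
  components-connected L v₀ conn = ≤-trans (sum-mono at-label) (≤-reflexive (sum-δ (label L v₀) (λ _ → 1)))
    where
    at-label : ∀ i → pos (size L i) ≤ ind (label L v₀ ≟ᶠ i) * 1
    at-label i with label L v₀ ≟ᶠ i
    ... | yes _ = pos≤1 (size L i)
    ... | no ≢i = ≤-trans (pos≤ (size L i)) (≤-reflexive (sum-zero (λ v → cong (_* 1)
      (ind-no (label L v ≟ᶠ i) (λ e → ≢i (trans (constant L (conn v₀ v)) e))))))

-- One colour in an extension step

one big : ℕ → ℕ
one 1 = 1
one _ = 0
big 1 = 0
big n = n

one+big : ∀ n → one n + big n ≡ n
one+big 0             = refl
one+big 1             = refl
one+big (suc (suc n)) = refl

one+pos-big : ∀ n → one n + pos (big n) ≡ pos n
one+pos-big 0             = refl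
one+pos-big 1             = refl
one+pos-big (suc (suc n)) = refl

merge-ones : ℕ → Fin M → Fin (suc M)
merge-ones 1 i = F.zero
merge-ones _ i = F.suc i

merge-ones-zero : ∀ n (i : Fin M) → ind (merge-ones n i ≟ᶠ F.zero) ≡ one n
merge-ones-zero 0             i = refl
merge-ones-zero 1             i = refl
merge-ones-zero (suc (suc n)) i = refl

merge-ones-≢1 : ∀ n (i : Fin M) → n ≢ 1 → merge-ones n i ≡ F.suc i
merge-ones-≢1 0             i _ = refl
merge-ones-≢1 1             i n = contradiction refl n
merge-ones-≢1 (suc (suc n)) i _ = refl

merge-ones-suc⁻¹ : ∀ n {i i′ : Fin M} → merge-ones n i ≡ F.suc i′ → i ≡ i′
merge-ones-suc⁻¹ 0             refl = refl
merge-ones-suc⁻¹ (suc (suc n)) refl = refl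

-- Deficits d are spread over the classes of ℓ. Classes of deficit 1 share the
-- single class zero of κ, so that bounding it leaves some other class open.
module Classes {m M : ℕ} (ℓ : Fin m → Fin M) (d : Fin m → ℕ) where

  δᶜ : Fin M → ℕ
  δᶜ = classSum ℓ d

  κ : Fin m → Fin (suc M)
  κ v = merge-ones (δᶜ (ℓ v)) (ℓ v)

  class-zero : ∀ f → classSum κ f F.zero ≡ sumFin (λ i → one (δᶜ i) * classSum ℓ f i)
  class-zero f = trans (sum-cong (λ v → cong (_* f v) (merge-ones-zero (δᶜ (ℓ v)) (ℓ v))))
                       (sum-via-classes ℓ (λ i → one (δᶜ i)) f)

  class-suc : ∀ f i → δᶜ i ≢ 1 → classSum κ f (F.suc i) ≡ classSum ℓ f i
  class-suc f i δ≢1 = sum-cong (λ v → cong (_* f v)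
    (ind-⇔ (κ v ≟ᶠ F.suc i) (ℓ v ≟ᶠ i) (merge-ones-suc⁻¹ (δᶜ (ℓ v))) (λ { refl → merge-ones-≢1 (δᶜ i) i δ≢1 })))

  ones : ℕ
  ones = sumFin (λ i → one (δᶜ i))

  class-zero-d : classSum κ d F.zero ≡ ones
  class-zero-d = trans (class-zero d) (sum-cong (λ i → one* (δᶜ i)))
    where
    one* : ∀ n → one n * n ≡ one n
    one* 0             = refl
    one* 1             = refl
    one* (suc (suc n)) = refl

-- One colour while `p` vertices are missing: `x` holds the edges to the next vertex, and `h` counts
-- the edges to come between missing vertices. `C` and `T` count the components with positive
-- deficit and those that `x` touches.
module ColourStep {m M : ℕ} (ℓ : Fin m → Fin M) (d x : Fin m → ℕ) (r p h : ℕ) (1<p : 1 < p) where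

  open Classes ℓ d

  xᶜ : Fin M → ℕ
  xᶜ = classSum ℓ x

  D X C T : ℕ
  D = sumFin d
  X = sumFin x
  C = sumFin (λ i → pos (δᶜ i))
  T = sumFin (λ i → pos (xᶜ i))

  module _ (half   : D + 2 * h ≡ r * p)
           (excess : p + C ≤ D + h + 1) where

    -- A component of deficit 1 contributes 1 to both sides of `excess`; cancelling leaves p + Bᶜ ≤
    -- B + h + 1 for the others. If the claim failed, `half` would give B + 2h < p. Together these
    -- force h = Bᶜ = 0, hence B = 0 and p ≤ 1.
    ones-room : ones + p ≤ r * p
    ones-room with ones + p ≤? r * p
    ... | yes ok = ok
    ... | no ¬ok = contradiction (≤-trans 1<p p≤1) (<-irrefl refl)
      where
      open ≤-Reasoning
      B Bᶜ : ℕ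
      B  = sumFin (λ i → big (δᶜ i))
      Bᶜ = sumFin (λ i → pos (big (δᶜ i)))
      D≡ : ones + B ≡ D
      D≡ = trans (sym (sum-+ (λ i → one (δᶜ i)) (λ i → big (δᶜ i))))
                 (trans (sum-cong (λ i → one+big (δᶜ i))) (sum-classSum ℓ d))
      C≡ : ones + Bᶜ ≡ C
      C≡ = trans (sym (sum-+ (λ i → one (δᶜ i)) (λ i → pos (big (δᶜ i)))))
                 (sum-cong (λ i → one+pos-big (δᶜ i)))
      B+2h<p : B + 2 * h < p
      B+2h<p = +-cancelˡ-< ones _ _ (begin-strict
        ones + (B + 2 * h)   ≡⟨ +-assoc ones B (2 * h) ⟨
        ones + B + 2 * h     ≡⟨ cong (_+ 2 * h) D≡ ⟩
        D + 2 * h            ≡⟨ half ⟩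
        r * p                <⟨ ≰⇒> ¬ok ⟩
        ones + p             ∎)
      p+Bᶜ≤ : p + Bᶜ ≤ B + h + 1
      p+Bᶜ≤ = +-cancelˡ-≤ ones _ _ (begin
        ones + (p + Bᶜ)      ≡⟨ e₁ ones p Bᶜ ⟩
        p + (ones + Bᶜ)      ≡⟨ cong (p +_) C≡ ⟩
        p + C                ≤⟨ excess ⟩
        D + h + 1            ≡⟨ cong (λ z → z + h + 1) D≡ ⟨
        ones + B + h + 1     ≡⟨ e₂ ones B h ⟩
        ones + (B + h + 1)   ∎)
        where
        e₁ : ∀ a b c → a + (b + c) ≡ b + (a + c)
        e₁ = solve-∀
        e₂ : ∀ a b c → a + b + c + 1 ≡ a + (b + c + 1)
        e₂ = solve-∀
      h+Bᶜ≤0 : h + Bᶜ ≤ 0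
      h+Bᶜ≤0 = +-cancelˡ-≤ (B + h + 1) _ _ (begin
        B + h + 1 + (h + Bᶜ)     ≡⟨ e B h Bᶜ ⟩
        suc (B + 2 * h) + Bᶜ     ≤⟨ +-monoˡ-≤ Bᶜ B+2h<p ⟩
        p + Bᶜ                   ≤⟨ p+Bᶜ≤ ⟩
        B + h + 1                ≡⟨ +-identityʳ _ ⟨
        B + h + 1 + 0            ∎)
        where
        e : ∀ a b c → a + b + 1 + (b + c) ≡ suc (a + 2 * b) + c
        e = solve-∀
      h≡0 : h ≡ 0
      h≡0 = n≤0⇒n≡0 (≤-trans (m≤m+n h Bᶜ) h+Bᶜ≤0)
      B≡0 : B ≡ 0
      B≡0 = sum-zero (λ i → pos≡0 (n≤0⇒n≡0 (≤-trans (term≤sum (λ i → pos (big (δᶜ i))) i) (≤-trans (m≤n+m Bᶜ h) h+Bᶜ≤0))))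
      p≤1 : p ≤ 1
      p≤1 = begin
        p            ≤⟨ m≤m+n p Bᶜ ⟩
        p + Bᶜ       ≤⟨ p+Bᶜ≤ ⟩
        B + h + 1    ≡⟨ cong₂ (λ a b → a + b + 1) B≡0 h≡0 ⟩
        1            ∎

    module _ (x≤d      : ∀ v → x v ≤ d v)
             (class-<  : ∀ i → classSum κ x i * p < classSum κ d i + p)
             (column-< : X * p < D + p)
             (column-> : D < X * p + p) where

      private
        xᶜ≤δᶜ : ∀ i → xᶜ i ≤ δᶜ i
        xᶜ≤δᶜ = classSum-mono ℓ x≤d

        xᶜ-< : ∀ i → xᶜ i * p < δᶜ i + p
        xᶜ-< i with δᶜ i ≟ 1
        ... | no δ≢1  = subst₂ (λ a b → a * p < b + p) (class-suc x i δ≢1) (class-suc d i δ≢1) (class-< (F.suc i))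
        -- A component inside the merged class has no rounding bound of its own, but its share is at
        -- most its deficit 1, which suffices.
        ... | yes δ≡1 = subst (λ b → xᶜ i * p < b + p) (sym δ≡1)
          (s≤s (≤-trans (*-monoˡ-≤ p (subst (xᶜ i ≤_) δ≡1 (xᶜ≤δᶜ i))) (≤-reflexive (*-identityˡ p))))

        0<p : 0 < p
        0<p = <⇒≤ 1<p

        instance
          p-nonZero : NonZero p
          p-nonZero = >-nonZero 0<p

      X≤r : X ≤ r
      X≤r = s≤s⁻¹ (*-cancelʳ-< p X (suc r) (begin-strict
        X * p            <⟨ column-< ⟩
        D + p            ≤⟨ +-monoˡ-≤ p (m≤m+n D (2 * h)) ⟩
        D + 2 * h + p    ≡⟨ cong (_+ p) half ⟩
        r * p + p        ≡⟨ +-comm (r * p) p ⟩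
        suc r * p        ∎))
        where open ≤-Reasoning

      -- The new vertex still needs r - X edges to missing vertices, and `h` must provide them.
      -- Otherwise (h + X + 1)p ≤ rp = D + 2h < Xp + p + 2h, so hp < 2h, against p ≥ 2.
      r≤h+X : r ≤ h + X
      r≤h+X with r ≤? h + X
      ... | yes ok = ok
      ... | no ¬ok = contradiction (begin-strict
        h * p + (X * p + p)    ≡⟨ e h X p ⟩
        suc (h + X) * p        ≤⟨ *-monoˡ-≤ p (≰⇒> ¬ok) ⟩
        r * p                  ≡⟨ half ⟨
        D + 2 * h              <⟨ +-monoˡ-< (2 * h) column-> ⟩
        X * p + p + 2 * h      ≡⟨ +-comm (X * p + p) (2 * h) ⟩
        2 * h + (X * p + p)    ≤⟨ +-monoˡ-≤ (X * p + p) (≤-trans (*-monoˡ-≤ h 1<p) (≤-reflexive (*-comm p h))) ⟩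
        h * p + (X * p + p)    ∎) (<-irrefl refl)
        where
        open ≤-Reasoning
        e : ∀ h X p → h * p + (X * p + p) ≡ suc (h + X) * p
        e = solve-∀

      -- This is `excess` for the next stage: p drops by 1, C becomes C - T + 1, and D + h drops by
      -- X, since the r - X edges still due at the new vertex only move from h to D. If no component
      -- receives two edges, X = T.
      excess-kept : p + C + X ≤ D + h + 1 + T
      excess-kept with any? (λ i → 1 <? xᶜ i)
      ... | no ¬big = +-mono-≤ excess (≤-reflexive (trans (sym (sum-classSum ℓ x)) (sum-cong (λ i → x≡pos (xᶜ i) (≮⇒≥ (λ lt → ¬big (i , lt)))))))
        where
        x≡pos : ∀ n → n ≤ 1 → n ≡ pos n
        x≡pos 0 _ = refl
        x≡pos 1 _ = refl
        x≡pos (suc (suc n)) (s≤s ())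
      ... | yes (i , 1<xᵢ) = begin
        p + C + X                                        ≡⟨ cong (p + C +_) (sum-classSum ℓ x) ⟨
        p + C + sumFin xᶜ                                ≡⟨ trans (+-assoc p C (sumFin xᶜ)) (+-comm p (C + sumFin xᶜ)) ⟩
        C + sumFin xᶜ + p                                ≡⟨ cong (_+ p) (sum-+ (λ i → pos (δᶜ i)) xᶜ) ⟨
        sumFin (λ i → pos (δᶜ i) + xᶜ i) + p             ≤⟨ sum-mono-at (λ i → termwise (δᶜ i) (xᶜ i) (xᶜ≤δᶜ i)) i
                                                              (gap p (δᶜ i) (xᶜ i) 0<p 1<xᵢ (xᶜ-< i)) ⟩
        sumFin (λ i → δᶜ i + pos (xᶜ i)) + 1             ≡⟨ cong (_+ 1) (sum-+ δᶜ (λ i → pos (xᶜ i))) ⟩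
        sumFin δᶜ + T + 1                                ≡⟨ cong (λ z → z + T + 1) (sum-classSum ℓ d) ⟩
        D + T + 1                                        ≤⟨ m≤m+n _ h ⟩
        D + T + 1 + h                                    ≡⟨ e D T h ⟩
        D + h + 1 + T                                    ∎
        where
        open ≤-Reasoning
        e : ∀ a b c → a + b + 1 + c ≡ a + c + 1 + b
        e = solve-∀
        termwise : ∀ δ x → x ≤ δ → pos δ + x ≤ δ + pos x
        termwise δ zero _ = +-monoˡ-≤ 0 (pos≤ δ)
        termwise (suc δ) (suc x) le = ≤-trans (s≤s le) (≤-reflexive (+-comm 1 (suc δ)))
        -- Here δ > (x - 1)p ≥ p + x - 2, so this one component makes up for the whole `p`; the
        -- others need only `termwise`.
        gap : ∀ p δ x → 0 < p → 1 < x → x * p < δ + p → pos δ + x + p ≤ δ + pos x + 1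
        gap p@(suc p-1) δ (suc (suc y)) _ (s≤s (s≤s _)) lt = begin
          pos δ + suc (suc y) + p        ≤⟨ +-monoˡ-≤ p (+-monoˡ-≤ (suc (suc y)) (pos≤1 δ)) ⟩
          1 + suc (suc y) + p            ≡⟨ e₁ y p ⟩
          suc (p + y) + 2                ≤⟨ +-monoˡ-≤ 2 (s≤s (+-monoʳ-≤ p (m≤m*n y p))) ⟩
          suc (p + y * p) + 2            ≤⟨ +-monoˡ-≤ 2 δ> ⟩
          δ + 2                          ≡⟨ +-assoc δ 1 1 ⟨
          δ + 1 + 1                      ∎
          where
          e₁ : ∀ y p → 1 + suc (suc y) + p ≡ suc (p + y) + 2
          e₁ = solve-∀
          δ> : p + y * p < δ
          δ> = +-cancelˡ-< p _ _ (subst (p + (p + y * p) <_) (+-comm δ p) lt)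

      -- This keeps the component of the new vertex from being regular. If X ≥ r, `ones-room` and
      -- the rounding of the merged class leave fewer than X edges for components of deficit 1. So
      -- some edge goes to a component of larger deficit, which is not exhausted.
      open-class : X < r ⊎ ∃ λ v → 0 < xᶜ (ℓ v) × x v < d v
      open-class with X <? r
      ... | yes X<r = inj₁ X<r
      ... | no X≮r  = inj₂ (pick (sum-<⇒∃ (λ i → one (δᶜ i) * xᶜ i) xᶜ ones-x<X))
        where
        open ≤-Reasoning
        ones-x<X : sumFin (λ i → one (δᶜ i) * xᶜ i) < sumFin xᶜ
        ones-x<X = *-cancelʳ-< p _ _ (begin-strict
          sumFin (λ i → one (δᶜ i) * xᶜ i) * p     ≡⟨ cong (_* p) (class-zero x) ⟨
          classSum κ x F.zero * p                  <⟨ class-< F.zero ⟩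
          classSum κ d F.zero + p                  ≡⟨ cong (_+ p) class-zero-d ⟩
          ones + p                                 ≤⟨ ones-room ⟩
          r * p                                    ≤⟨ *-monoˡ-≤ p (≮⇒≥ X≮r) ⟩
          X * p                                    ≡⟨ cong (_* p) (sum-classSum ℓ x) ⟨
          sumFin xᶜ * p                            ∎)
        -- Exhausting δ ≥ 2 would mean δp < δ + p, impossible for p ≥ 2.
        x<δ : ∀ p δ x → 1 < p → x ≤ δ → one δ * x < x → x * p < δ + p → x < δ
        x<δ _ 1 x _ _ lt _ = contradiction lt (<-irrefl (*-identityˡ x))
        x<δ _ 0 zero _ _ () _
        x<δ _ (suc (suc δ)) x 1<p x≤δ _ lt with m≤n⇒m<n∨m≡n x≤δ
        ... | inj₁ x<δ = x<δ
        x<δ (suc (suc q)) (suc (suc y)) .(suc (suc y)) (s≤s (s≤s z≤n)) x≤δ _ lt | inj₂ refl =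
          contradiction (<-≤-trans lt (≤-trans (m≤m+n _ (y + q + y * q)) (≤-reflexive (e y q)))) (<-irrefl refl)
          where
          e : ∀ y q → 2 + y + (2 + q) + (y + q + y * q) ≡ (2 + y) * (2 + q)
          e = solve-∀
        pick : (∃ λ i → one (δᶜ i) * xᶜ i < xᶜ i) → ∃ λ v → 0 < xᶜ (ℓ v) × x v < d v
        pick (i , lt) with classSum-<⇒∃ ℓ x d i (x<δ p (δᶜ i) (xᶜ i) 1<p (xᶜ≤δᶜ i) lt (xᶜ-< i))
        ... | v , refl , xv<dv = v , ≤-<-trans z≤n lt , xv<dv

-- Sufficiency

attach : (χ : EdgeColouring m lam k) → Fin k → (x : Fin m → Fin k → ℕ) → (∀ v → sumFin (x v) ≡ lam) →
  Σ (EdgeColouring (suc m) lam k) λ χ′ → Σ (χ ◁ χ′) λ e → ∀ j v → AddVertex.new χ χ′ e j v ≡ x v j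
attach {lam = lam} χ i₀ x rows = grow , ◁-grow , λ j v → trans (mult-grow j v) (proj₂ (distribute lam (x v) (rows v)) j)
  where open Grow χ (λ v → proj₁ (distribute lam (x v) (rows v))) i₀

restrict : ∀ {m n} → m ≤ n → EdgeColouring n lam k → EdgeColouring m lam k
restrict m≤n ψ = record
  { col = λ u v → col ψ (inject≤ u m≤n) (inject≤ v m≤n)
  ; sym = λ u v → EdgeColouring.sym ψ (inject≤ u m≤n) (inject≤ v m≤n) }

inject≤-inject₁ : ∀ {m n} (m≤n : m ≤ n) (sm≤n : suc m ≤ n) (u : Fin m) → inject≤ (inject₁ u) sm≤n ≡ inject≤ u m≤n
inject≤-inject₁ m≤n sm≤n u = toℕ-injective
  (trans (toℕ-inject≤ (inject₁ u) sm≤n) (trans (toℕ-inject₁ u) (sym (toℕ-inject≤ u m≤n))))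

◁-Extends : ∀ {m n} (χ : EdgeColouring m lam k) (χ′ : EdgeColouring (suc m) lam k) (ψ : EdgeColouring n lam k) (m≤n : m ≤ n) (sm≤n : suc m ≤ n) →
  χ ◁ χ′ → Extends sm≤n χ′ ψ → Extends m≤n χ ψ
◁-Extends χ χ′ ψ m≤n sm≤n e ext u v c u≢v = trans
  (cong₂ (λ a b → col ψ a b c) (sym (inject≤-inject₁ m≤n sm≤n u)) (sym (inject≤-inject₁ m≤n sm≤n v)))
  (trans (ext (inject₁ u) (inject₁ v) c (u≢v ∘ inject₁-injective)) (e u v c u≢v))

Extends-refl : ∀ {n} (ψ : EdgeColouring n lam k) → Extends ≤-refl ψ ψ
Extends-refl ψ u v c _ = cong₂ (λ a b → col ψ a b c) (inject≤-refl u ≤-refl) (inject≤-refl v ≤-refl)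


module Extension (n r lam k H : ℕ) (total : k * r + lam ≡ n * lam) (even : r * n ≡ 2 * H) (i₀ : Fin k) where

  -- The induction invariant: (ii) in positive form as `deficient`, and (iii) doubled and free of
  -- subtraction. One `labels` serves all colours, so that the rounding has a single type of
  -- classes.
  record Extendable {m : ℕ} (χ : EdgeColouring m lam k) : Set where
    field
      {labels} : ℕ
      L        : ∀ j → Labelling χ j labels
      bounded  : ∀ v j → deg χ v j ≤ r
      deficient : ∀ j v → ∃ λ u → label (L j) u ≡ label (L j) v × deg χ u j < r
      lower    : ∀ j → 2 * (r * m) ≤ degSum χ j + r * n
      upper    : ∀ j → degSum χ j + 2 * n + 2 * components (L j) ≤ r * n + 2 * m + 2

  module Deficit {χ : EdgeColouring m lam k} (S : Extendable χ) where
    open Extendable S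

    d : Fin m → Fin k → ℕ
    d v j = r ∸ deg χ v j

    deg+d : ∀ v j → deg χ v j + d v j ≡ r
    deg+d v j = m+[n∸m]≡n (bounded v j)

    D : Fin k → ℕ
    D j = sumFin (λ v → d v j)

    D+degSum : ∀ j → D j + degSum χ j ≡ r * m
    D+degSum j = begin
      D j + degSum χ j                            ≡⟨ sum-+ (λ v → d v j) (λ v → deg χ v j) ⟨
      sumFin (λ v → d v j + deg χ v j)            ≡⟨ sum-cong (λ v → trans (+-comm (d v j) (deg χ v j)) (deg+d v j)) ⟩
      sumFin {m} (λ _ → r)                        ≡⟨ sum-const m r ⟩
      m * r                                       ≡⟨ *-comm m r ⟩
      r * m                                       ∎
      where open ≡-Reasoning

    -- What a vertex lacks over all colours is its `lam` edges to each of the `p` missing vertices.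
    d-row : ∀ {p} → n ≡ p + m → ∀ v → sumFin (d v) ≡ lam * p
    d-row {p} n≡ v = +-cancelʳ-≡ (m * lam) _ _ (begin
      sumFin (d v) + m * lam                            ≡⟨ cong (sumFin (d v) +_) (sum-deg χ v) ⟨
      sumFin (d v) + (sumFin (deg χ v) + lam)           ≡⟨ e (sumFin (d v)) (sumFin (deg χ v)) lam ⟩
      sumFin (deg χ v) + sumFin (d v) + lam             ≡⟨ cong (_+ lam) (sum-+ (deg χ v) (d v)) ⟨
      sumFin (λ j → deg χ v j + d v j) + lam            ≡⟨ cong (_+ lam) (trans (sum-cong (deg+d v)) (sum-const k r)) ⟩
      k * r + lam                                       ≡⟨ trans total (cong (_* lam) n≡) ⟩
      (p + m) * lam                                     ≡⟨ trans (*-distribʳ-+ lam p m) (cong (_+ m * lam) (*-comm p lam)) ⟩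
      lam * p + m * lam                                 ∎)
      where
      open ≡-Reasoning
      e : ∀ a b c → a + (b + c) ≡ b + a + c
      e = solve-∀

    deficient-d : ∀ j v → ∃ λ u → label (L j) u ≡ label (L j) v × 0 < d u j
    deficient-d j v with deficient j v
    ... | u , e , lt = u , e , m<n⇒0<n∸m lt

  complete : {χ : EdgeColouring m lam k} → n ≡ 1 + m → Extendable χ →
    Σ (EdgeColouring (suc m) lam k) λ χ′ → (χ ◁ χ′) × IsConnectedFactorization χ′ r
  complete {m} {χ} n≡ S = from-attached (attach χ i₀ d (λ v → trans (d-row n≡ v) (*-identityʳ lam)))
    where
    open Extendable S
    open Deficit S
    -- With one vertex missing, `lower` says that no colour needs more than `r` edges to it. All
    -- deficits together make `m * lam`, which is `k * r`, so each colour needs exactly `r`.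
    D≤r : ∀ j → D j ≤ r
    D≤r j = +-cancelʳ-≤ (degSum χ j + r * m) _ _ (begin
      D j + (degSum χ j + r * m)        ≡⟨ +-assoc (D j) (degSum χ j) (r * m) ⟨
      D j + degSum χ j + r * m          ≡⟨ cong (_+ r * m) (D+degSum j) ⟩
      r * m + r * m                     ≡⟨ e₁ (r * m) ⟩
      2 * (r * m)                       ≤⟨ lower j ⟩
      degSum χ j + r * n                ≡⟨ cong (λ z → degSum χ j + r * z) n≡ ⟩
      degSum χ j + r * (1 + m)          ≡⟨ e₂ (degSum χ j) r m ⟩
      r + (degSum χ j + r * m)          ∎)
      where
      open ≤-Reasoning
      e₁ : ∀ a → a + a ≡ 2 * a
      e₁ = solve-∀
      e₂ : ∀ a b c → a + b * (1 + c) ≡ b + (a + b * c)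
      e₂ = solve-∀
    D≡r : ∀ j → D j ≡ r
    D≡r = sum-tight D≤r (≤-reflexive (begin
      sumFin {k} (λ _ → r)              ≡⟨ sum-const k r ⟩
      k * r                             ≡⟨ +-cancelʳ-≡ lam _ _ (trans total (trans (cong (_* lam) n≡) (+-comm lam (m * lam)))) ⟩
      m * lam                           ≡⟨ sum-const m lam ⟨
      sumFin {m} (λ _ → lam)            ≡⟨ sum-cong (λ v → trans (d-row n≡ v) (*-identityʳ lam)) ⟨
      sumFin (λ v → sumFin (d v))       ≡⟨ sum-swap d ⟩
      sumFin D                          ∎))
      where open ≡-Reasoning
    module _ (χ′ : EdgeColouring (suc m) lam k) (e : χ ◁ χ′) (new≡d : ∀ j v → AddVertex.new χ χ′ e j v ≡ d v j) where
      regular : ∀ j v → deg χ′ v j ≡ r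
      regular j v with view v
      ... | ‵fromℕ     = trans (AddVertex.deg-new χ χ′ e j) (trans (sum-cong (new≡d j)) (D≡r j))
      ... | ‵inject₁ v = trans (AddVertex.deg-old χ χ′ e j v) (trans (cong (deg χ v j +_) (new≡d j v)) (deg+d v j))
      from-new : ∀ j v → Reach χ′ j (fromℕ m) v
      from-new j v with view v
      ... | ‵fromℕ     = here
      ... | ‵inject₁ v with deficient-d j v
      ...   | u , eq , lt = reach-trans χ′ (step here (AddVertex.new-pos⇒adj χ χ′ e j (subst (0 <_) (sym (new≡d j u)) lt)))
                                           (AddVertex.reach-lift χ χ′ e j (joined (L j) u v eq))
    from-attached : (Σ (EdgeColouring (suc m) lam k) λ χ′ → Σ (χ ◁ χ′) λ e → ∀ j v → AddVertex.new χ χ′ e j v ≡ d v j) →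
      Σ (EdgeColouring (suc m) lam k) λ χ′ → (χ ◁ χ′) × IsConnectedFactorization χ′ r
    from-attached (χ′ , e , new≡d) = χ′ , e , λ j → regular χ′ e new≡d j ,
      λ u v → reach-trans χ′ (reach-sym χ′ (from-new χ′ e new≡d j u)) (from-new χ′ e new≡d j v)

  module GrowStep {p} (1<p : 1 < p) {χ : EdgeColouring m lam k} (n≡ : n ≡ p + m) (S : Extendable χ) where
    open Extendable S
    open Deficit S

    private
      instance
        p-nonZero : NonZero p
        p-nonZero = >-nonZero (<⇒≤ 1<p)

    κ : Fin m → Fin k → Fin (suc labels)
    κ v j = Classes.κ (label (L j)) (λ v → d v j) v

    module Rounded (R : Rounding m k (suc labels) lam p κ d (d-row n≡))
                   (χ′ : EdgeColouring (suc m) lam k) (e : χ ◁ χ′)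
                   (new≡x : ∀ j v → AddVertex.new χ χ′ e j v ≡ Rounding.x R v j) where

      open Rounding R

      module Colour (j : Fin k) where
        open AddVertex χ χ′ e j
        open Relabel (L j)
        module Step = ColourStep (label (L j)) (λ v → d v j) (λ v → x v j) r p
        ℓ : Fin m → Fin labels
        ℓ = label (L j)

        X : ℕ
        X = sumFin (λ v → x v j)

        -- With rn = 2H, this is the number of edges of colour j joining two
        -- vertices still to be added.
        h : ℕ
        h = (H + edges χ j) ∸ r * m

        -- Makes the truncated subtraction in `h` exact.
        rm≤ : r * m ≤ H + edges χ j
        rm≤ = *-cancelˡ-≤ 2 (begin
          2 * (r * m)                  ≤⟨ lower j ⟩
          degSum χ j + r * n           ≡⟨ cong₂ _+_ (handshake χ j) even ⟩
          2 * edges χ j + 2 * H        ≡⟨ e₁ (edges χ j) H ⟩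
          2 * (H + edges χ j)          ∎)
          where
          open ≤-Reasoning
          e₁ : ∀ a b → 2 * a + 2 * b ≡ 2 * (b + a)
          e₁ = solve-∀

        rn : r * n ≡ r * p + r * m
        rn = trans (cong (r *_) n≡) (*-distribˡ-+ r p m)

        half : D j + 2 * h ≡ r * p
        half = +-cancelʳ-≡ (degSum χ j + r * m) _ _ (begin
          D j + 2 * h + (degSum χ j + r * m)        ≡⟨ e₁ (D j) h (degSum χ j) (r * m) ⟩
          D j + degSum χ j + r * m + 2 * h          ≡⟨ cong (λ z → z + r * m + 2 * h) (D+degSum j) ⟩
          r * m + r * m + 2 * h                     ≡⟨ e₂ (r * m) h ⟩
          2 * (h + r * m)                           ≡⟨ cong (2 *_) (m∸n+n≡m rm≤) ⟩
          2 * (H + edges χ j)                       ≡⟨ *-distribˡ-+ 2 H (edges χ j) ⟩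
          2 * H + 2 * edges χ j                     ≡⟨ cong₂ _+_ even (handshake χ j) ⟨
          r * n + degSum χ j                        ≡⟨ cong (_+ degSum χ j) rn ⟩
          r * p + r * m + degSum χ j                ≡⟨ e₃ (r * p) (r * m) (degSum χ j) ⟩
          r * p + (degSum χ j + r * m)              ∎)
          where
          open ≡-Reasoning
          e₁ : ∀ a b c d → a + 2 * b + (c + d) ≡ a + c + d + 2 * b
          e₁ = solve-∀
          e₂ : ∀ a b → a + a + 2 * b ≡ 2 * (b + a)
          e₂ = solve-∀
          e₃ : ∀ a b c → a + b + c ≡ a + (c + b)
          e₃ = solve-∀

        -- By `deficient` every component has positive deficit, so none escapes the count `C`.
        C≡components : Step.C h 1<p ≡ components (L j)
        C≡components = sum-cong (λ i → pos-⇔ (δ⇒size i) (size⇒δ i))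
          where
          δ⇒size : ∀ i → 0 < classSum ℓ (λ v → d v j) i → 0 < size (L j) i
          δ⇒size i s with classSum-pos⇒∃ ℓ (λ v → d v j) i s
          ... | v , refl , _ = term≤classSum ℓ (λ _ → 1) v
          size⇒δ : ∀ i → 0 < size (L j) i → 0 < classSum ℓ (λ v → d v j) i
          size⇒δ i s with classSum-pos⇒∃ ℓ (λ _ → 1) i s
          ... | v , refl , _ with deficient-d j v
          ...   | u , ℓu≡ℓv , lt = subst (λ i → 0 < classSum ℓ (λ v → d v j) i) ℓu≡ℓv
                  (<-≤-trans lt (term≤classSum ℓ (λ v → d v j) u))

        -- Half of `upper`, after rn is split into rp, which is D + 2h by `half`, and rm, which is D
        -- plus the degree sum.
        excess : p + Step.C h 1<p ≤ D j + h + 1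
        excess = *-cancelˡ-≤ 2 (+-cancelʳ-≤ (degSum χ j + 2 * m) _ _ (begin
          2 * (p + Step.C h 1<p) + (degSum χ j + 2 * m)     ≡⟨ cong (λ c → 2 * (p + c) + (degSum χ j + 2 * m)) C≡components ⟩
          2 * (p + c) + (degSum χ j + 2 * m)                ≡⟨ e₁ p c (degSum χ j) m ⟩
          degSum χ j + 2 * (p + m) + 2 * c                  ≡⟨ cong (λ z → degSum χ j + 2 * z + 2 * c) n≡ ⟨
          degSum χ j + 2 * n + 2 * c                        ≤⟨ upper j ⟩
          r * n + 2 * m + 2                                 ≡⟨ cong (λ z → z + 2 * m + 2) (trans rn (cong₂ _+_ (sym half) (sym (D+degSum j)))) ⟩
          D j + 2 * h + (D j + degSum χ j) + 2 * m + 2      ≡⟨ e₂ (D j) h (degSum χ j) m ⟩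
          2 * (D j + h + 1) + (degSum χ j + 2 * m)          ∎))
          where
          open ≤-Reasoning
          c : ℕ
          c = components (L j)
          e₁ : ∀ p c t m → 2 * (p + c) + (t + 2 * m) ≡ t + 2 * (p + m) + 2 * c
          e₁ = solve-∀
          e₂ : ∀ d h t m → d + 2 * h + (d + t) + 2 * m + 2 ≡ 2 * (d + h + 1) + (t + 2 * m)
          e₂ = solve-∀

        x≤d : ∀ v → x v j ≤ d v j
        x≤d v = entry-≤ v j

        X≤r : X ≤ r
        X≤r = Step.X≤r h 1<p half excess x≤d (class-< j) (column-< j) (column-> j)

        r≤h+X : r ≤ h + X
        r≤h+X = Step.r≤h+X h 1<p half excess x≤d (class-< j) (column-< j) (column-> j)

        excess-kept : p + Step.C h 1<p + X ≤ D j + h + 1 + Step.T h 1<p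
        excess-kept = Step.excess-kept h 1<p half excess x≤d (class-< j) (column-< j) (column-> j)

        sum-new : sumFin new ≡ X
        sum-new = sum-cong (new≡x j)

        touch≡ : ∀ i → touch i ≡ classSum ℓ (λ v → x v j) i
        touch≡ = classSum-cong ℓ (new≡x j)

        touched≡T : touched ≡ Step.T h 1<p
        touched≡T = sum-cong (λ i → cong pos (touch≡ i))

        degSum′ : degSum χ′ j ≡ degSum χ j + 2 * X
        degSum′ = trans sum-deg-grow (cong (λ z → degSum χ j + 2 * z) sum-new)

        deg-old′ : ∀ v → deg χ′ (inject₁ v) j ≡ deg χ v j + x v j
        deg-old′ v = trans (deg-old v) (cong (deg χ v j +_) (new≡x j v))

        deg-new′ : deg χ′ (fromℕ m) j ≡ X
        deg-new′ = trans deg-new sum-new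

        bounded′ : ∀ v → deg χ′ v j ≤ r
        bounded′ v with view v
        ... | ‵fromℕ     = ≤-trans (≤-reflexive deg-new′) X≤r
        ... | ‵inject₁ v = ≤-trans (≤-reflexive (deg-old′ v)) (≤-trans (+-monoʳ-≤ (deg χ v j) (x≤d v)) (≤-reflexive (deg+d v j)))

        lower′ : 2 * (r * suc m) ≤ degSum χ′ j + r * n
        lower′ = begin
          2 * (r * suc m)                                          ≡⟨ e₁ r m ⟩
          2 * (r * m) + 2 * r                                      ≤⟨ +-monoʳ-≤ (2 * (r * m)) (*-monoʳ-≤ 2 r≤h+X) ⟩
          2 * (r * m) + 2 * (h + X)                                ≡⟨ e₂ (r * m) h X ⟩
          r * m + r * m + 2 * h + 2 * X                            ≡⟨ cong (λ z → z + r * m + 2 * h + 2 * X) (D+degSum j) ⟨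
          D j + degSum χ j + r * m + 2 * h + 2 * X                 ≡⟨ e₃ (D j) (degSum χ j) (r * m) h X ⟩
          degSum χ j + 2 * X + (D j + 2 * h + r * m)               ≡⟨ cong₂ _+_ degSum′ (trans rn (cong (_+ r * m) (sym half))) ⟨
          degSum χ′ j + r * n                                      ∎
          where
          open ≤-Reasoning
          e₁ : ∀ r m → 2 * (r * suc m) ≡ 2 * (r * m) + 2 * r
          e₁ = solve-∀
          e₂ : ∀ a h x → 2 * a + 2 * (h + x) ≡ a + a + 2 * h + 2 * x
          e₂ = solve-∀
          e₃ : ∀ d t a h x → d + t + a + 2 * h + 2 * x ≡ t + 2 * x + (d + 2 * h + a)
          e₃ = solve-∀

        upper′ : degSum χ′ j + 2 * n + 2 * components labelling′ ≤ r * n + 2 * suc m + 2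
        upper′ = +-cancelʳ-≤ (2 * touched) _ _ (begin
          degSum χ′ j + 2 * n + 2 * components labelling′ + 2 * touched
            ≡⟨ cong (λ z → z + 2 * n + 2 * components labelling′ + 2 * touched) degSum′ ⟩
          degSum χ j + 2 * X + 2 * n + 2 * components labelling′ + 2 * touched
            ≡⟨ e₁ (degSum χ j) X n (components labelling′) touched ⟩
          degSum χ j + 2 * X + 2 * n + 2 * (components labelling′ + touched)
            ≡⟨ cong₂ (λ z c → degSum χ j + 2 * X + 2 * z + 2 * c) n≡ components-grow ⟩
          degSum χ j + 2 * X + 2 * (p + m) + 2 * suc (components (L j))
            ≡⟨ e₂ (degSum χ j) X p m (components (L j)) ⟩
          2 * (p + components (L j) + X) + (degSum χ j + 2 * m + 2)
            ≡⟨ cong (λ c → 2 * (p + c + X) + (degSum χ j + 2 * m + 2)) C≡components ⟨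
          2 * (p + Step.C h 1<p + X) + (degSum χ j + 2 * m + 2)
            ≤⟨ +-monoˡ-≤ (degSum χ j + 2 * m + 2) (*-monoʳ-≤ 2 excess-kept) ⟩
          2 * (D j + h + 1 + Step.T h 1<p) + (degSum χ j + 2 * m + 2)
            ≡⟨ cong (λ t → 2 * (D j + h + 1 + t) + (degSum χ j + 2 * m + 2)) touched≡T ⟨
          2 * (D j + h + 1 + touched) + (degSum χ j + 2 * m + 2)
            ≡⟨ e₃ (D j) h touched (degSum χ j) m ⟩
          D j + 2 * h + (D j + degSum χ j) + 2 * suc m + 2 + 2 * touched
            ≡⟨ cong (λ z → z + 2 * suc m + 2 + 2 * touched) (trans rn (cong₂ _+_ (sym half) (sym (D+degSum j)))) ⟨
          r * n + 2 * suc m + 2 + 2 * touched ∎)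
          where
          open ≤-Reasoning
          e₁ : ∀ t x n c u → t + 2 * x + 2 * n + 2 * c + 2 * u ≡ t + 2 * x + 2 * n + 2 * (c + u)
          e₁ = solve-∀
          e₂ : ∀ t x p m c → t + 2 * x + 2 * (p + m) + 2 * suc c ≡ 2 * (p + c + x) + (t + 2 * m + 2)
          e₂ = solve-∀
          e₃ : ∀ d h u t m → 2 * (d + h + 1 + u) + (t + 2 * m + 2) ≡ d + 2 * h + (d + t) + 2 * suc m + 2 + 2 * u
          e₃ = solve-∀

        deficient-merged : ∃ λ u → label′ u ≡ F.zero × deg χ′ u j < r
        deficient-merged = from-open (Step.open-class h 1<p half excess x≤d (class-< j) (column-< j) (column-> j))
          where
          from-open : X < r ⊎ (∃ λ v → 0 < classSum ℓ (λ v → x v j) (ℓ v) × x v j < d v j) →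
            ∃ λ u → label′ u ≡ F.zero × deg χ′ u j < r
          from-open (inj₁ X<r) = fromℕ m , label-new , subst (_< r) (sym deg-new′) X<r
          from-open (inj₂ (v , 0<xᶜ , x<d)) = inject₁ v
            , trans (label-old v) (merge-pos (subst (0 <_) (sym (touch≡ (ℓ v))) 0<xᶜ))
            , subst₂ _<_ (sym (deg-old′ v)) (deg+d v j) (+-monoʳ-< (deg χ v j) x<d)

        -- An untouched component gets no new edge and keeps its deficient vertex; a touched one now
        -- belongs to the component of the new vertex.
        deficient-old : ∀ v → ∃ λ u → label′ u ≡ relabel (ℓ v) × deg χ′ u j < r
        deficient-old v with touch (ℓ v) in t
        ... | suc _ = deficient-merged
        ... | zero with deficient j v
        ...   | u , ℓu≡ℓv , lt = inject₁ u
              , trans (label-old u) (trans (cong relabel ℓu≡ℓv) (cong (λ t → merge t (ℓ v)) t))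
              , subst (_< r) (sym (trans (deg-old u) (trans (cong (deg χ u j +_) new≡0) (+-identityʳ _)))) lt
          where
          new≡0 : new u ≡ 0
          new≡0 = n≤0⇒n≡0 (≤-trans (term≤classSum ℓ new u) (≤-reflexive (trans (cong touch ℓu≡ℓv) t)))

        deficient′ : ∀ v → ∃ λ u → label′ u ≡ label′ v × deg χ′ u j < r
        deficient′ v with view v
        ... | ‵fromℕ = proj₁ merged , trans (proj₁ (proj₂ merged)) (sym label-new) , proj₂ (proj₂ merged)
          where merged = deficient-merged
        ... | ‵inject₁ v = proj₁ old , trans (proj₁ (proj₂ old)) (sym (label-old v)) , proj₂ (proj₂ old)
          where old = deficient-old v

      extendable : Extendable χ′
      extendable = record
        { L = λ j → AddVertex.Relabel.labelling′ χ χ′ e j (L j)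
        ; bounded = λ v j → Colour.bounded′ j v
        ; deficient = Colour.deficient′
        ; lower = Colour.lower′
        ; upper = Colour.upper′ }

    from-rounding : Rounding m k (suc labels) lam p κ d (d-row n≡) →
      Σ (EdgeColouring (suc m) lam k) λ χ′ → (χ ◁ χ′) × Extendable χ′
    from-rounding R with attach χ i₀ (Rounding.x R) (Rounding.row-sum R)
    ... | χ′ , e , new≡x = χ′ , e , Rounded.extendable R χ′ e new≡x

    grow-step : Σ (EdgeColouring (suc m) lam k) λ χ′ → (χ ◁ χ′) × Extendable χ′
    grow-step = from-rounding (round m k (suc labels) lam p κ d (d-row n≡))

  extend : ∀ q {m} {χ : EdgeColouring m lam k} (m≤n : m ≤ n) → n ≡ suc q + m → Extendable χ →
    Σ (EdgeColouring n lam k) λ ψ → Extends m≤n χ ψ × IsConnectedFactorization ψ r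
  extend zero {m} {χ} m≤n n≡ S = last n≡ (complete n≡ S)
    where
    last : n ≡ suc m → (Σ (EdgeColouring (suc m) lam k) λ χ′ → (χ ◁ χ′) × IsConnectedFactorization χ′ r) →
      Σ (EdgeColouring n lam k) λ ψ → Extends m≤n χ ψ × IsConnectedFactorization ψ r
    last refl (χ′ , e , conn) = χ′ , ◁-Extends χ χ′ χ′ m≤n ≤-refl e (Extends-refl χ′) , conn
  extend (suc q) {m} {χ} m≤n n≡ S = further (GrowStep.grow-step (s≤s (s≤s z≤n)) n≡ S)
    where
    n≡′ : n ≡ suc q + suc m
    n≡′ = trans n≡ (cong suc (sym (+-suc q m)))
    sm≤n : suc m ≤ n
    sm≤n = subst (suc m ≤_) (sym n≡′) (m≤n+m (suc m) (suc q))
    further : (Σ (EdgeColouring (suc m) lam k) λ χ′ → (χ ◁ χ′) × Extendable χ′) →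
      Σ (EdgeColouring n lam k) λ ψ → Extends m≤n χ ψ × IsConnectedFactorization ψ r
    further (χ′ , e , S′) with extend q sm≤n n≡′ S′
    ... | ψ , ext , conn = ψ , ◁-Extends χ χ′ ψ m≤n sm≤n e ext , conn

-- Necessity

module Necessity (n r : ℕ) {lam k : ℕ} where

  -- Condition (ii) fails for the full factorization, whose classes are regular. `spread` holds
  -- there too: a regular component must be the whole graph.
  record Necessary {m : ℕ} (χ : EdgeColouring m lam k) : Set where
    field
      bounded : ∀ v j → deg χ v j ≤ r
      lower   : ∀ j → 2 * (r * m) ≤ degSum χ j + r * n
      upper   : ∀ j {M} (L : Labelling χ j M) → degSum χ j + 2 * n + 2 * components L ≤ r * n + 2 * m + 2
      spread  : ∀ j v → (∀ u → Reach χ j v u → deg χ u j ≡ r) → ∀ u → Reach χ j v u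

  connected : {ψ : EdgeColouring n lam k} → Fin n → IsConnectedFactorization ψ r → Necessary ψ
  connected {ψ} v₀ conn = record
    { bounded = λ v j → ≤-reflexive (proj₁ (conn j) v)
    ; lower = λ j → ≤-reflexive (trans (e₁ (r * n)) (cong (_+ r * n) (sym (sum≡ j))))
    ; upper = λ j L → ≤-trans (+-monoʳ-≤ (degSum ψ j + 2 * n) (*-monoʳ-≤ 2 (components-connected L v₀ (proj₂ (conn j)))))
                              (≤-reflexive (cong (λ z → z + 2 * n + 2) (sum≡ j)))
    ; spread = λ j v _ u → proj₂ (conn j) v u }
    where
    sum≡ : ∀ j → degSum ψ j ≡ r * n
    sum≡ j = trans (sum-cong (proj₁ (conn j))) (trans (sum-const n r) (*-comm n r))
    e₁ : ∀ a → 2 * a ≡ a + a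
    e₁ = solve-∀

  module Remove (χ : EdgeColouring m lam k) (χ′ : EdgeColouring (suc m) lam k) (e : χ ◁ χ′) (N′ : Necessary χ′) where
    module N′ = Necessary N′

    module _ (j : Fin k) where
      open AddVertex χ χ′ e j

      new≤r : sumFin new ≤ r
      new≤r = subst (_≤ r) deg-new (N′.bounded (fromℕ m) j)

      lower : 2 * (r * m) ≤ degSum χ j + r * n
      lower = +-cancelʳ-≤ (2 * r) _ _ (begin
        2 * (r * m) + 2 * r                          ≡⟨ e₁ r m ⟩
        2 * (r * suc m)                              ≤⟨ N′.lower j ⟩
        degSum χ′ j + r * n                          ≡⟨ cong (_+ r * n) sum-deg-grow ⟩
        degSum χ j + 2 * sumFin new + r * n          ≤⟨ +-monoˡ-≤ (r * n) (+-monoʳ-≤ (degSum χ j) (*-monoʳ-≤ 2 new≤r)) ⟩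
        degSum χ j + 2 * r + r * n                   ≡⟨ e₂ (degSum χ j) (2 * r) (r * n) ⟩
        degSum χ j + r * n + 2 * r                   ∎)
        where
        open ≤-Reasoning
        e₁ : ∀ r m → 2 * (r * m) + 2 * r ≡ 2 * (r * suc m)
        e₁ = solve-∀
        e₂ : ∀ a b c → a + b + c ≡ a + c + b
        e₂ = solve-∀

      upper : ∀ {M} (L : Labelling χ j M) → degSum χ j + 2 * n + 2 * components L ≤ r * n + 2 * m + 2
      upper L = +-cancelʳ-≤ (2 * sumFin new + 2) _ _ (begin
        degSum χ j + 2 * n + 2 * components L + (2 * sumFin new + 2)
          ≡⟨ e₁ (degSum χ j) n (components L) (sumFin new) ⟩
        degSum χ j + 2 * sumFin new + 2 * n + 2 * suc (components L)
          ≡⟨ cong₂ (λ t c → t + 2 * n + 2 * c) (sym sum-deg-grow) (sym components-grow) ⟩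
        degSum χ′ j + 2 * n + 2 * (components labelling′ + touched)
          ≡⟨ e₂ (degSum χ′ j) n (components labelling′) touched ⟩
        degSum χ′ j + 2 * n + 2 * components labelling′ + 2 * touched
          ≤⟨ +-mono-≤ (N′.upper j labelling′) (*-monoʳ-≤ 2 touched≤new) ⟩
        r * n + 2 * suc m + 2 + 2 * sumFin new
          ≡⟨ e₃ (r * n) m (sumFin new) ⟩
        r * n + 2 * m + 2 + (2 * sumFin new + 2) ∎)
        where
        open ≤-Reasoning
        open Relabel L
        e₁ : ∀ t n c x → t + 2 * n + 2 * c + (2 * x + 2) ≡ t + 2 * x + 2 * n + 2 * suc c
        e₁ = solve-∀
        e₂ : ∀ t n c u → t + 2 * n + 2 * (c + u) ≡ t + 2 * n + 2 * c + 2 * u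
        e₂ = solve-∀
        e₃ : ∀ a m x → a + 2 * suc m + 2 + 2 * x ≡ a + 2 * m + 2 + (2 * x + 2)
        e₃ = solve-∀

      saturated : ∀ u → deg χ u j ≡ r → new u ≡ 0
      saturated u eq = n≤0⇒n≡0 (+-cancelˡ-≤ (deg χ u j) _ _
        (≤-trans (≤-reflexive (sym (deg-old u))) (≤-trans (N′.bounded (inject₁ u) j) (≤-reflexive (sym (trans (+-identityʳ _) eq))))))

      module _ (v : Fin m) (reg : ∀ u → Reach χ j v u → deg χ u j ≡ r) where

        -- The vertices of a regular component already have degree `r`, so by `saturated` none has
        -- an edge to the new vertex, and no path can escape.
        stays-old : ∀ {w} → Reach χ′ j (inject₁ v) w → ∃ λ u → w ≡ inject₁ u × Reach χ j v u
        stays-old here = v , refl , here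
        stays-old (step {w = w} p a) with stays-old p | view w
        ... | u , refl , q | ‵fromℕ     =
              contradiction (subst (0 <_) (saturated u (reg u q)) (adj⇒new-pos (adj-sym χ′ a))) λ ()
        ... | u , refl , q | ‵inject₁ w = w , refl , step q (adj-lower a)

        -- The component stays regular in `χ′`, so `spread` makes it reach the new vertex, against
        -- `stays-old`. The arbitrary result type serves both (ii) and `spread`.
        regular-impossible : ∀ {A : Set} → A
        regular-impossible with stays-old (N′.spread j (inject₁ v) regular′ (fromℕ m))
          where
          regular′ : ∀ w → Reach χ′ j (inject₁ v) w → deg χ′ w j ≡ r
          regular′ w p with stays-old p
          ... | u , refl , q = trans (deg-old u) (trans (cong₂ _+_ (reg u q) (saturated u (reg u q))) (+-identityʳ r))
        ... | u , eq , _ = contradiction eq fromℕ≢inject₁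

    noRegular : NoRegularComponent χ r
    noRegular j v reg = regular-impossible j v reg

    necessary : Necessary χ
    necessary = record
      { bounded = λ v j → ≤-trans (≤-trans (m≤m+n _ _) (≤-reflexive (sym (AddVertex.deg-old χ χ′ e j v)))) (N′.bounded (inject₁ v) j)
      ; lower = lower
      ; upper = upper
      ; spread = λ j v reg _ → regular-impossible j v reg }

  -- The stages above `χ` are restrictions of `ψ`; the recursion climbs to `ψ`, where `connected`
  -- applies, and each return removes one vertex.
  necessity : ∀ q {m} (χ : EdgeColouring m lam k) (m≤n : m ≤ n) → n ≡ suc q + m → (ψ : EdgeColouring n lam k) →
    Extends m≤n χ ψ → Fin n → IsConnectedFactorization ψ r → Necessary χ × NoRegularComponent χ r
  necessity zero χ m≤n refl ψ ext v₀ conn = Remove.necessary χ ψ χ◁ψ (connected v₀ conn) , Remove.noRegular χ ψ χ◁ψ (connected v₀ conn)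
    where
    χ◁ψ : χ ◁ ψ
    χ◁ψ u v c u≢v = trans
      (cong₂ (λ a b → col ψ a b c) (inject₁≡ u) (inject₁≡ v))
      (ext u v c u≢v)
      where
      inject₁≡ : ∀ u → inject₁ u ≡ inject≤ u m≤n
      inject₁≡ u = trans (sym (inject≤-refl (inject₁ u) ≤-refl)) (inject≤-inject₁ m≤n ≤-refl u)
  necessity (suc q) {m} χ m≤n n≡ ψ ext v₀ conn = Remove.necessary χ χ′ χ◁χ′ N′ , Remove.noRegular χ χ′ χ◁χ′ N′
    where
    n≡′ : n ≡ suc q + suc m
    n≡′ = trans n≡ (cong suc (sym (+-suc q m)))
    sm≤n : suc m ≤ n
    sm≤n = subst (suc m ≤_) (sym n≡′) (m≤n+m (suc m) (suc q))
    χ′ : EdgeColouring (suc m) lam k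
    χ′ = restrict sm≤n ψ
    χ◁χ′ : χ ◁ χ′
    χ◁χ′ u v c u≢v = trans
      (cong₂ (λ a b → col ψ a b c) (inject≤-inject₁ m≤n sm≤n u) (inject≤-inject₁ m≤n sm≤n v))
      (ext u v c u≢v)
    N′ : Necessary χ′
    N′ = proj₁ (necessity q χ′ sm≤n n≡′ ψ (λ _ _ _ _ → refl) v₀ conn)

-- Conditions (i) to (iii) and the two inductions

theorem7p6 : (n m r lam : ℕ) → .{{_ : NonZero r}} → 0 < lam → 2 < m → (m<n : m < n) →
    (χ : EdgeColouring m lam (lam * (n ∸ 1) / r)) → IsPartialFactorization χ r →
    (Σ (EdgeColouring n lam (lam * (n ∸ 1) / r))
    (λ ψ → Extends (<⇒≤ m<n) χ ψ × IsConnectedFactorization ψ r))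
    ⇔
    (TwoAdmissible n r lam × NoRegularComponent χ r ×
    (∀ (j : Fin (lam * (n ∸ 1) / r)) (c : ℕ) → IsComponentCount χ j c →
    (2 * (r * m) ≤ 2 * edges χ j + r * n) ×
    (2 * edges χ j + 2 * n + 2 * c ≤ r * n + 2 * m + 2)))
theorem7p6 n@(suc n-1) m r lam 0<lam 2<m m<n χ partial = mk⇔ forward backward
  where
  K q : ℕ
  K = lam * n-1 / r
  q = n ∸ suc m

  n≡ : n ≡ suc q + m
  n≡ = trans (sym (m∸n+n≡m m<n)) (+-suc q m)

  v₀ : Fin m
  v₀ = fromℕ< (≤-trans (s≤s z≤n) 2<m)

  -- That there is a colour at all is read off `χ`; a meaningless diagonal value will do.
  i₀ : Fin K
  i₀ = col χ v₀ v₀ (fromℕ< 0<lam)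

  forward : (Σ (EdgeColouring n lam K) λ ψ → Extends (<⇒≤ m<n) χ ψ × IsConnectedFactorization ψ r) →
    TwoAdmissible n r lam × NoRegularComponent χ r ×
    (∀ (j : Fin K) (c : ℕ) → IsComponentCount χ j c →
      (2 * (r * m) ≤ 2 * edges χ j + r * n) × (2 * edges χ j + 2 * n + 2 * c ≤ r * n + 2 * m + 2))
  forward (ψ , ext , conn) = (divides (edges ψ i₀) rn≡ , divides K lam*n-1≡) , proj₂ both , λ j c cc →
      subst (λ t → 2 * (r * m) ≤ t + r * n) (handshake χ j) (lower j) ,
      subst₂ (λ t c → t + 2 * n + 2 * c ≤ r * n + 2 * m + 2) (handshake χ j) (components-fromCount cc) (upper j (fromCount cc))
    where
    both : Necessity.Necessary n r χ × NoRegularComponent χ r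
    both = Necessity.necessity n r q χ (<⇒≤ m<n) n≡ ψ ext F.zero conn
    open Necessity.Necessary (proj₁ both)
    -- The parity in (i) comes from the edges of one colour, the divisibility from one vertex summed
    -- over all colours.
    rn≡ : r * n ≡ edges ψ i₀ * 2
    rn≡ = begin
      r * n                            ≡⟨ *-comm r n ⟩
      n * r                            ≡⟨ sum-const n r ⟨
      sumFin {n} (λ _ → r)             ≡⟨ sum-cong (proj₁ (conn i₀)) ⟨
      sumFin (λ v → deg ψ v i₀)        ≡⟨ handshake ψ i₀ ⟩
      2 * edges ψ i₀                   ≡⟨ *-comm 2 (edges ψ i₀) ⟩
      edges ψ i₀ * 2                   ∎
      where open ≡-Reasoning
    lam*n-1≡ : lam * n-1 ≡ K * r
    lam*n-1≡ = begin
      lam * n-1                        ≡⟨ *-comm lam n-1 ⟩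
      n-1 * lam                        ≡⟨ +-cancelʳ-≡ lam _ _ (trans (sum-deg ψ F.zero) (+-comm lam (n-1 * lam))) ⟨
      sumFin (deg ψ F.zero)            ≡⟨ sum-cong (λ j → proj₁ (conn j) F.zero) ⟩
      sumFin {K} (λ _ → r)             ≡⟨ sum-const K r ⟩
      K * r                            ∎
      where open ≡-Reasoning

  backward : TwoAdmissible n r lam × NoRegularComponent χ r ×
    (∀ (j : Fin K) (c : ℕ) → IsComponentCount χ j c →
      (2 * (r * m) ≤ 2 * edges χ j + r * n) × (2 * edges χ j + 2 * n + 2 * c ≤ r * n + 2 * m + 2)) →
    Σ (EdgeColouring n lam K) λ ψ → Extends (<⇒≤ m<n) χ ψ × IsConnectedFactorization ψ r
  backward ((divides H rn≡ , r∣) , noRegular , bounds) = extend q (<⇒≤ m<n) n≡ record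
    { L = labelling χ
    ; bounded = partial
    ; deficient = deficient
    ; lower = λ j → subst (λ t → 2 * (r * m) ≤ t + r * n) (sym (handshake χ j)) (proj₁ (bound j))
    ; upper = λ j → subst (λ t → t + 2 * n + 2 * components (labelling χ j) ≤ r * n + 2 * m + 2) (sym (handshake χ j)) (proj₂ (bound j)) }
    where
    total : K * r + lam ≡ n * lam
    total = trans (cong (_+ lam) (trans (m/n*n≡m r∣) (*-comm lam n-1))) (+-comm (n-1 * lam) lam)
    open Extension n r lam K H total (trans rn≡ (*-comm H 2)) i₀
    bound : ∀ j → (2 * (r * m) ≤ 2 * edges χ j + r * n) × (2 * edges χ j + 2 * n + 2 * components (labelling χ j) ≤ r * n + 2 * m + 2)
    bound j = bounds j _ (componentCount (labelling χ j))
    -- A finite search turns the negated universal in (ii) into a witness; labels replace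
    -- reachability because their equality is decidable.
    deficient : ∀ j v → ∃ λ u → label (labelling χ j) u ≡ label (labelling χ j) v × deg χ u j < r
    deficient j v with any? (λ u → (label (labelling χ j) u ≟ᶠ label (labelling χ j) v) ×-dec (deg χ u j <? r))
    ... | yes found = found
    ... | no ¬found = contradiction
      (λ u p → ≤-antisym (partial u j) (≮⇒≥ (λ lt → ¬found (u , sym (constant (labelling χ j) p) , lt))))
      (noRegular j v)
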